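{- Every minimal unordered field is algebraically closed.
   Context: An infinite first-order structure $M$ is minimal if every subset of $M$ definable in $M$ with parameters is finite or co-finite. A minimal field is a minimal structure which is a field, possibly with additional first-order structure. A structure $M$ is ordered if there is a strict partial order on $M$ (on singletons) which is definable in $M$ with parameters but is not definable (with parameters) from equality alone; otherwise $M$ is unordered. (These are not ordered fields in the usual algebraic sense.) -}

module Defs where

open import Algebra.Bundles using (CommutativeRing)
open import Data.Empty using () renaming (⊥ to ∅)
open import Data.Empty.Polymorphic using (⊥)
open import Data.Fin using (Fin)
open import Data.Fin.Patterns using (0F; 1F)
open import Data.List using (List; []; _∷_)
open import Data.List.Relation.Unary.Any using (Any)
open import Data.Nat using (ℕ; suc) renaming (_+_ to _+ℕ_)
open import Data.Product using (∃; ∃-syntax; _×_)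
open import Data.Sum using (_⊎_; inj₁; inj₂)
open import Data.Vec.Functional using (Vector; _++_) renaming (_∷_ to _◂_)
open import Function.Bundles using (_⇔_)
open import Level using (Level; _⊔_) renaming (suc to lsuc; zero to lzero)
open import Relation.Binary.Bundles using (Setoid)
open import Relation.Binary.Core using (Rel)
open import Relation.Binary.Structures using (IsStrictPartialOrder)
open import Relation.Nullary using (¬_)
open import Relation.Unary using (Pred; U; ∁)

record Signature (f r : Level) : Set (lsuc (f ⊔ r)) where
  field
    FunctionSymbol : ℕ → Set f
    RelationSymbol : ℕ → Set r

-- Variables are de Bruijn indices: a `Term L n` or `Formula L n` has its free
-- variables among the n elements of `Fin n`, and a quantifier binds 0F.

data Term {f r : Level} (L : Signature f r) (n : ℕ) : Set f where
  var  : Fin n → Term L n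
  func : ∀ {k} → Signature.FunctionSymbol L k → (Fin k → Term L n) → Term L n

infix  7 _≐_
infixr 6 _∧′_
infixr 5 _∨′_
infixr 4 _⇒′_

data Formula {f r : Level} (L : Signature f r) : ℕ → Set (f ⊔ r) where
  _≐_            : ∀ {n} → Term L n → Term L n → Formula L n
  rel            : ∀ {n k} → Signature.RelationSymbol L k → (Fin k → Term L n) → Formula L n
  ⊥′             : ∀ {n} → Formula L n
  _∧′_ _∨′_ _⇒′_ : ∀ {n} → Formula L n → Formula L n → Formula L n
  ∀′_ ∃′_        : ∀ {n} → Formula L (suc n) → Formula L n

-- The equality of the structure is the equality of the carrier setoid.

record Structure {ℓ f r : Level} (L : Signature f r) (S : Setoid ℓ ℓ) :
                 Set (lsuc ℓ ⊔ f ⊔ r) where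
  open Setoid S
  open Signature L
  field
    ⟦_⟧ᶠ      : ∀ {k} → FunctionSymbol k → Vector Carrier k → Carrier
    ⟦_⟧ᶠ-cong : ∀ {k} (g : FunctionSymbol k) {u v : Vector Carrier k} →
                (∀ i → u i ≈ v i) → ⟦ g ⟧ᶠ u ≈ ⟦ g ⟧ᶠ v
    ⟦_⟧ʳ      : ∀ {k} → RelationSymbol k → Vector Carrier k → Set ℓ
    ⟦_⟧ʳ-resp : ∀ {k} (R : RelationSymbol k) {u v : Vector Carrier k} →
                (∀ i → u i ≈ v i) → ⟦ R ⟧ʳ u → ⟦ R ⟧ʳ v

module _ {ℓ f r : Level} {L : Signature f r} {S : Setoid ℓ ℓ} (M : Structure L S) where
  open Setoid S
  open Structure M

  evalTerm : ∀ {n} → Term L n → Vector Carrier n → Carrier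
  evalTerm (var i)     v = v i
  evalTerm (func g ts) v = ⟦ g ⟧ᶠ (λ i → evalTerm (ts i) v)

  Satisfies : ∀ {n} → Formula L n → Vector Carrier n → Set ℓ
  Satisfies (s ≐ t)    v = evalTerm s v ≈ evalTerm t v
  Satisfies (rel R ts) v = ⟦ R ⟧ʳ (λ i → evalTerm (ts i) v)
  Satisfies ⊥′         v = ⊥
  Satisfies (φ ∧′ ψ)   v = Satisfies φ v × Satisfies ψ v
  Satisfies (φ ∨′ ψ)   v = Satisfies φ v ⊎ Satisfies ψ v
  Satisfies (φ ⇒′ ψ)   v = Satisfies φ v → Satisfies ψ v
  Satisfies (∀′ φ)     v = ∀ x → Satisfies φ (x ◂ v)
  Satisfies (∃′ φ)     v = ∃[ x ] Satisfies φ (x ◂ v)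

  -- Definability with parameters: `a` is the tuple of parameters.
  Definable : ∀ {n} → Pred (Vector Carrier n) ℓ → Set (ℓ ⊔ f ⊔ r)
  Definable {n} D = ∃[ m ] ∃[ φ ] ∃[ a ]
    (∀ v → D v ⇔ Satisfies {n +ℕ m} φ (v ++ a))

  DefinableSet : Pred Carrier ℓ → Set (ℓ ⊔ f ⊔ r)
  DefinableSet D = Definable {1} (λ v → D (v 0F))

  DefinableRel : Rel Carrier ℓ → Set (ℓ ⊔ f ⊔ r)
  DefinableRel _R_ = Definable {2} (λ v → v 0F R v 1F)

emptySignature : Signature lzero lzero
emptySignature = record { FunctionSymbol = λ _ → ∅ ; RelationSymbol = λ _ → ∅ }

pureSet : ∀ {ℓ} (S : Setoid ℓ ℓ) → Structure emptySignature S
pureSet S = record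
  { ⟦_⟧ᶠ = λ () ; ⟦_⟧ᶠ-cong = λ () ; ⟦_⟧ʳ = λ () ; ⟦_⟧ʳ-resp = λ () }

module _ {ℓ p : Level} (S : Setoid ℓ ℓ) where
  open Setoid S

  Finite : Pred Carrier p → Set (ℓ ⊔ p)
  Finite D = ∃[ xs ] (∀ x → D x → Any (x ≈_) xs)

  Cofinite : Pred Carrier p → Set (ℓ ⊔ p)
  Cofinite D = ∃[ xs ] (∀ x → ∁ D x → Any (x ≈_) xs)

module _ {ℓ f r : Level} {L : Signature f r} {S : Setoid ℓ ℓ} (M : Structure L S) where
  open Setoid S

  Minimal : Set (lsuc ℓ ⊔ f ⊔ r)
  Minimal = ¬ Finite S U ×
            (∀ (D : Pred Carrier ℓ) → DefinableSet M D → Finite S D ⊎ Cofinite S D)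

  Ordered : Set (lsuc ℓ ⊔ f ⊔ r)
  Ordered = ∃ λ (_<_ : Rel Carrier ℓ) →
    IsStrictPartialOrder _≈_ _<_ ×
    DefinableRel M _<_ × ¬ DefinableRel (pureSet S) _<_

  Unordered : Set (lsuc ℓ ⊔ f ⊔ r)
  Unordered = ¬ Ordered

record Field (ℓ : Level) : Set (lsuc ℓ) where
  field
    commutativeRing : CommutativeRing ℓ ℓ
  open CommutativeRing commutativeRing public
  field
    0≉1     : 0# ≉ 1#
    inverse : ∀ x → x ≉ 0# → ∃[ y ] x * y ≈ 1#

data RingOperation : ℕ → Set where
  add mul  : RingOperation 2
  neg      : RingOperation 1
  zero one : RingOperation 0

withRing : ∀ {f r} → Signature f r → Signature f r
withRing L = record
  { FunctionSymbol = λ k → RingOperation k ⊎ Signature.FunctionSymbol L k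
  ; RelationSymbol = Signature.RelationSymbol L
  }

module _ {ℓ f r : Level} (K : Field ℓ) {L : Signature f r} where
  open Field K

  expansion : Structure L setoid → Structure (withRing L) setoid
  expansion A = record
    { ⟦_⟧ᶠ      = interpret
    ; ⟦_⟧ᶠ-cong = interpret-cong
    ; ⟦_⟧ʳ      = Structure.⟦_⟧ʳ A
    ; ⟦_⟧ʳ-resp = Structure.⟦_⟧ʳ-resp A
    }
    where
    interpret : ∀ {k} → Signature.FunctionSymbol (withRing L) k →
                Vector Carrier k → Carrier
    interpret (inj₁ add)  v = v 0F + v 1F
    interpret (inj₁ mul)  v = v 0F * v 1F
    interpret (inj₁ neg)  v = - v 0F
    interpret (inj₁ zero) v = 0#
    interpret (inj₁ one)  v = 1#
    interpret (inj₂ g)    v = Structure.⟦_⟧ᶠ A g v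

    interpret-cong : ∀ {k} (g : Signature.FunctionSymbol (withRing L) k)
                     {u v : Vector Carrier k} →
                     (∀ i → u i ≈ v i) → interpret g u ≈ interpret g v
    interpret-cong (inj₁ add)  e = +-cong (e 0F) (e 1F)
    interpret-cong (inj₁ mul)  e = *-cong (e 0F) (e 1F)
    interpret-cong (inj₁ neg)  e = -‿cong (e 0F)
    interpret-cong (inj₁ zero) e = refl
    interpret-cong (inj₁ one)  e = refl
    interpret-cong (inj₂ g)    e = Structure.⟦_⟧ᶠ-cong A g e

module _ {ℓ : Level} (K : Field ℓ) where
  open Field K

  -- The list a₀ ∷ a₁ ∷ … ∷ aₙ ∷ [] represents a₀ + a₁X + … + aₙXⁿ; leading
  -- coefficients may vanish.
  Polynomial : Set ℓ
  Polynomial = List Carrier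

  evalPoly : Polynomial → Carrier → Carrier
  evalPoly []       x = 0#
  evalPoly (a ∷ as) x = a + x * evalPoly as x

  NonConstant : Polynomial → Set ℓ
  NonConstant []       = ⊥
  NonConstant (a ∷ as) = Any (_≉ 0#) as

  AlgebraicallyClosed : Set ℓ
  AlgebraicallyClosed = ∀ p → NonConstant p → ∃[ x ] evalPoly p x ≈ 0#

{-# OPTIONS --safe #-}
module Submission where

-- Write Q x for "for almost all x".  In an infinite group a definable set is cofinite iff it and
-- one of its translates cover the group, so Q preserves definability.  If Qx Qy P and Qy Qx ¬P,
-- then inclusion of the finite sets {u : ¬ P x u} is a definable order that almost all pairs
-- satisfy, and no such order is definable from equality; hence Q commutes with itself in the
-- unordered case.  This gives a dimension theory: almost all tuples of length n + 1 cannot be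
-- covered by a finite-to-one correspondence with tuples of length n, and a finite-to-one
-- correspondence between n-tuples is generically onto.
--
-- Let f be a polynomial of least degree d ≥ 2 without a root in K, so that L = K[X]/(f) is a
-- domain.  Sending (c, r₁, …, r_d) to the coefficients of c ∏ (Y − rᵢ) is finite-to-one, so almost
-- all polynomials of degree d split over K.  Each a ∈ L is a root of some nonzero polynomial of
-- degree at most d over K, which has finitely many roots in L, so almost all polynomials of degree
-- d have a root in L \ K.  No polynomial does both.

open import Axiom.ExcludedMiddle using (ExcludedMiddle)
open import Data.Empty using (⊥-elim) renaming (⊥ to ∅)
open import Data.Empty.Polymorphic using (⊥)
open import Data.Fin using (Fin; zero; suc; splitAt; _↑ˡ_; _↑ʳ_)
open import Data.Fin.Patterns using (0F; 1F)
open import Data.Fin.Properties using (splitAt-↑ˡ; splitAt-↑ʳ)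
open import Data.List using (List; []; _∷_; length; lookup; map; concatMap; tabulate) renaming (_++_ to _⧺_)
open import Data.List.Relation.Unary.All using (All; []; _∷_)
import Data.List.Relation.Unary.All as All
import Data.List.Relation.Unary.All.Properties as All
open import Data.List.Relation.Unary.Any using (Any; here; there)
import Data.List.Relation.Unary.Any as Any
import Data.List.Relation.Unary.Any.Properties as Any
open import Data.Nat using (ℕ; zero; suc; _≤_; s≤s; z≤n) renaming (_+_ to _+ℕ_)
import Data.Nat.Properties as ℕ
open import Data.Product using (∃; ∃-syntax; _×_; _,_; proj₁; proj₂)
open import Data.Sum using (_⊎_; inj₁; inj₂)
open import Data.Unit.Polymorphic using (⊤; tt)
open import Data.Vec using (Vec; []; _∷_)
open import Data.Vec.Functional using (Vector; _++_; tail) renaming (_∷_ to _◂_)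
open import Data.Vec.Relation.Unary.All using ([]; _∷_) renaming (All to Allᵛ)
open import Function using (_∘_)
open import Function.Bundles using (_⇔_; mk⇔; Equivalence)
open import Level using (Level; _⊔_) renaming (suc to lsuc)
open import Relation.Binary.Bundles using (Setoid)
open import Relation.Binary.Structures using (IsStrictPartialOrder)
open import Relation.Binary.PropositionalEquality as ≡ using (_≡_)
open import Relation.Nullary using (Dec; ¬_; yes; no)
open import Relation.Unary using (Pred; U)
open import Defs

open Equivalence using (to; from)

Tuple : ∀ {ℓ} → Set ℓ → ℕ → Set ℓ
Tuple C zero    = ⊤
Tuple C (suc n) = C × Tuple C n

-- Definable functions and predicates on vectors.

module Definability {ℓ f r : Level} {L : Signature f r} {S : Setoid ℓ ℓ} (M : Structure L S) where
  open Setoid S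
  open Structure M

  evalTerm-cong : ∀ {n} (t : Term L n) {u v : Vector Carrier n} →
                  (∀ i → u i ≈ v i) → evalTerm M t u ≈ evalTerm M t v
  evalTerm-cong (var i)     e = e i
  evalTerm-cong (func g ts) e = ⟦ g ⟧ᶠ-cong λ i → evalTerm-cong (ts i) e

  ◂-cong : ∀ {n} {u v : Vector Carrier n} {x} → (∀ i → u i ≈ v i) → ∀ i → (x ◂ u) i ≈ (x ◂ v) i
  ◂-cong e zero    = refl
  ◂-cong e (suc i) = e i

  Satisfies-resp : ∀ {n} (φ : Formula L n) {u v : Vector Carrier n} →
                   (∀ i → u i ≈ v i) → Satisfies M φ u → Satisfies M φ v
  Satisfies-resp (s ≐ t)    e p        = trans (sym (evalTerm-cong s e)) (trans p (evalTerm-cong t e))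
  Satisfies-resp (rel R ts) e p        = ⟦ R ⟧ʳ-resp (λ i → evalTerm-cong (ts i) e) p
  Satisfies-resp (φ ∧′ ψ)   e (p , q)  = Satisfies-resp φ e p , Satisfies-resp ψ e q
  Satisfies-resp (φ ∨′ ψ)   e (inj₁ p) = inj₁ (Satisfies-resp φ e p)
  Satisfies-resp (φ ∨′ ψ)   e (inj₂ p) = inj₂ (Satisfies-resp ψ e p)
  Satisfies-resp (φ ⇒′ ψ)   e p        = Satisfies-resp ψ e ∘ p ∘ Satisfies-resp φ (sym ∘ e)
  Satisfies-resp (∀′ φ)     e p        = λ x → Satisfies-resp φ (◂-cong e) (p x)
  Satisfies-resp (∃′ φ)     e (x , p)  = x , Satisfies-resp φ (◂-cong e) p

  rename : ∀ {n m} → (Fin n → Fin m) → Term L n → Term L m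
  rename ρ (var i)     = var (ρ i)
  rename ρ (func g ts) = func g λ i → rename ρ (ts i)

  evalTerm-rename : ∀ {n m} (ρ : Fin n → Fin m) (t : Term L n) (v : Vector Carrier m) →
                    evalTerm M (rename ρ t) v ≈ evalTerm M t (v ∘ ρ)
  evalTerm-rename ρ (var i)     v = refl
  evalTerm-rename ρ (func g ts) v = ⟦ g ⟧ᶠ-cong λ i → evalTerm-rename ρ (ts i) v

  ++-◂ : ∀ {n k} (v : Vector Carrier (suc n)) (b : Vector Carrier k) (i : Fin (n +ℕ k)) →
         (v ++ b) (suc i) ≈ (tail v ++ b) i
  ++-◂ {n} v b i with splitAt n i
  ... | inj₁ _ = refl
  ... | inj₂ _ = refl

  ◂-++ : ∀ {n k} x (v : Vector Carrier n) (b : Vector Carrier k) (i : Fin (suc n +ℕ k)) →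
         ((x ◂ v) ++ b) i ≈ (x ◂ (v ++ b)) i
  ◂-++ x v b zero    = refl
  ◂-++ x v b (suc i) = ++-◂ (x ◂ v) b i

  infix 4 _⊇_
  _⊇_ : ∀ {k} → Vector Carrier k → List Carrier → Set ℓ
  b ⊇ ps = All (λ c → ∃[ j ] b j ≈ c) ps

                                                                                          
                                                                                  

  -- Terms and formulas are required over every parameter tuple that contains a fixed list `ps`. Two
  -- definitions are then merged by concatenating their lists, and no formula has to be renamed.
  DefinableFun : ∀ {n} → (Vector Carrier n → Carrier) → Set (ℓ ⊔ f)
  DefinableFun {n} F = ∃[ ps ] (∀ {k} (b : Vector Carrier k) → b ⊇ ps →
    ∃[ t ] (∀ v → F v ≈ evalTerm M {n = n +ℕ k} t (v ++ b)))

  DefinablePred : ∀ {n} → Pred (Vector Carrier n) ℓ → Set (ℓ ⊔ f ⊔ r)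
  DefinablePred {n} D = ∃[ ps ] (∀ {k} (b : Vector Carrier k) → b ⊇ ps →
    ∃[ φ ] (∀ v → D v ⇔ Satisfies M {n = n +ℕ k} φ (v ++ b)))

  lookup-⊇ : ∀ ps → lookup ps ⊇ ps
  lookup-⊇ []       = []
  lookup-⊇ (c ∷ ps) = (zero , refl) ∷ All.map (λ (j , e) → suc j , e) (lookup-⊇ ps)

  definablePred⇒definable : ∀ {n} {D : Pred (Vector Carrier n) ℓ} → DefinablePred D → Definable M D
  definablePred⇒definable (ps , def) =
    let φ , h = def (lookup ps) (lookup-⊇ ps) in length ps , φ , lookup ps , h

  -- Satisfaction respects the equality of the carrier, so congruence comes for free with
  -- definability and is never assumed of a predicate.
  definablePred-resp : ∀ {n} {D : Pred (Vector Carrier n) ℓ} → DefinablePred D →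
                       ∀ {u v} → (∀ i → u i ≈ v i) → D u → D v
  definablePred-resp {n} D-def {u} {v} e =
    let m , φ , a , h = definablePred⇒definable D-def
    in from (h v) ∘ Satisfies-resp φ (++-cong a) ∘ to (h u)
    where
    ++-cong : ∀ {m} (a : Vector Carrier m) i → (u ++ a) i ≈ (v ++ a) i
    ++-cong a i with splitAt n i
    ... | inj₁ j = e j
    ... | inj₂ _ = refl

  definablePred-⇔ : ∀ {n} {D E : Pred (Vector Carrier n) ℓ} → (∀ v → D v ⇔ E v) →
                    DefinablePred D → DefinablePred E
  definablePred-⇔ eq (ps , def) = ps , λ b b⊇ →
    let φ , h = def b b⊇ in φ , λ v → mk⇔ (to (h v) ∘ from (eq v)) (to (eq v) ∘ from (h v))

  varF : ∀ {n} (i : Fin n) → DefinableFun (λ v → v i)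
  varF {n} i = [] , λ {k} b _ → var (i ↑ˡ k) , λ v → reflexive (lemma {k} b v)
    where
    lemma : ∀ {k} (b : Vector Carrier k) v → v i ≡ (v ++ b) (i ↑ˡ k)
    lemma {k} b v rewrite splitAt-↑ˡ n i k = ≡.refl

  constF : ∀ {n} c → DefinableFun {n} (λ _ → c)
  constF {n} c = (c ∷ []) , λ b b⊇ → param b (All.head b⊇)
    where
    lemma : ∀ {k} (b : Vector Carrier k) j v → b j ≡ (v ++ b) (n ↑ʳ j)
    lemma {k} b j v rewrite splitAt-↑ʳ n k j = ≡.refl

    param : ∀ {k} (b : Vector Carrier k) → ∃[ j ] b j ≈ c →
            ∃[ t ] (∀ v → c ≈ evalTerm M {n = n +ℕ k} t (v ++ b))
    param b (j , e) = var (n ↑ʳ j) , λ v → trans (sym e) (reflexive (lemma b j v))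

  weakenF : ∀ {n} {F : Vector Carrier n → Carrier} → DefinableFun F → DefinableFun (F ∘ tail)
  weakenF (ps , def) = ps , λ b b⊇ →
    let t , h = def b b⊇
    in rename suc t , λ v → trans (h (tail v)) (trans
         (evalTerm-cong t (sym ∘ ++-◂ v b)) (sym (evalTerm-rename suc t (v ++ b))))

  ≈D : ∀ {n} {F G : Vector Carrier n → Carrier} → DefinableFun F → DefinableFun G →
       DefinablePred (λ v → F v ≈ G v)
  ≈D (ps , F) (qs , G) = ps ⧺ qs , λ b b⊇ →
    let s , h = F b (All.++⁻ˡ ps b⊇)
        t , g = G b (All.++⁻ʳ ps b⊇)
    in s ≐ t , λ v → mk⇔ (λ e → trans (sym (h v)) (trans e (g v)))
                         (λ e → trans (h v) (trans e (sym (g v))))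

  module _ {n : ℕ} {D E : Pred (Vector Carrier n) ℓ} where
    ×D : DefinablePred D → DefinablePred E → DefinablePred (λ v → D v × E v)
    ×D (ps , D-def) (qs , E-def) = ps ⧺ qs , λ b b⊇ →
      let φ , h = D-def b (All.++⁻ˡ ps b⊇)
          ψ , g = E-def b (All.++⁻ʳ ps b⊇)
      in φ ∧′ ψ , λ v → mk⇔ (λ (p , q) → to (h v) p , to (g v) q)
                            (λ (p , q) → from (h v) p , from (g v) q)

    ⊎D : DefinablePred D → DefinablePred E → DefinablePred (λ v → D v ⊎ E v)
    ⊎D (ps , D-def) (qs , E-def) = ps ⧺ qs , λ b b⊇ →
      let φ , h = D-def b (All.++⁻ˡ ps b⊇)
          ψ , g = E-def b (All.++⁻ʳ ps b⊇)
      in φ ∨′ ψ , λ v → mk⇔ (λ { (inj₁ p) → inj₁ (to (h v) p) ; (inj₂ q) → inj₂ (to (g v) q) })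
                            (λ { (inj₁ p) → inj₁ (from (h v) p) ; (inj₂ q) → inj₂ (from (g v) q) })

    →D : DefinablePred D → DefinablePred E → DefinablePred (λ v → D v → E v)
    →D (ps , D-def) (qs , E-def) = ps ⧺ qs , λ b b⊇ →
      let φ , h = D-def b (All.++⁻ˡ ps b⊇)
          ψ , g = E-def b (All.++⁻ʳ ps b⊇)
      in (φ ⇒′ ψ) , λ v → mk⇔ (λ p → to (g v) ∘ p ∘ from (h v)) (λ p → from (g v) ∘ p ∘ to (h v))

  ⊥D : ∀ {n} → DefinablePred {n} (λ _ → ⊥)
  ⊥D = [] , λ _ _ → ⊥′ , λ _ → mk⇔ (λ ()) (λ ())

  ∀D : ∀ {n} {D : Pred (Vector Carrier (suc n)) ℓ} → DefinablePred D →
       DefinablePred (λ v → ∀ x → D (x ◂ v))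
  ∀D (ps , def) = ps , λ b b⊇ →
    let φ , h = def b b⊇
    in ∀′ φ , λ v → mk⇔
         (λ p x → Satisfies-resp φ (◂-++ x v b) (to (h _) (p x)))
         (λ p x → from (h _) (Satisfies-resp φ (sym ∘ ◂-++ x v b) (p x)))

  ∃D : ∀ {n} {D : Pred (Vector Carrier (suc n)) ℓ} → DefinablePred D →
       DefinablePred (λ v → ∃[ x ] D (x ◂ v))
  ∃D (ps , def) = ps , λ b b⊇ →
    let φ , h = def b b⊇
    in ∃′ φ , λ v → mk⇔
         (λ (x , p) → x , Satisfies-resp φ (◂-++ x v b) (to (h _) p))
         (λ (x , p) → x , from (h _) (Satisfies-resp φ (sym ∘ ◂-++ x v b) p))

  -- Definability over products of sorts.

  infixr 4 _⊗_
  -- Codes for finite products of the carrier, so that relations between tuples can be handled as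
  -- predicates on nested pairs instead of vectors.
  data Sort : Set where
    pt  : Sort
    tup : ℕ → Sort
    _⊗_ : Sort → Sort → Sort

  ⟦_⟧ : Sort → Set ℓ
  ⟦ pt ⟧    = Carrier
  ⟦ tup n ⟧ = Tuple Carrier n
  ⟦ a ⊗ b ⟧ = ⟦ a ⟧ × ⟦ b ⟧

  DefinableMap : ∀ c {n} → (Vector Carrier n → ⟦ c ⟧) → Set (ℓ ⊔ f)
  DefinableMap pt            F = DefinableFun F
  DefinableMap (tup zero)    F = ⊤
  DefinableMap (tup (suc n)) F = DefinableFun (proj₁ ∘ F) × DefinableMap (tup n) (proj₂ ∘ F)
  DefinableMap (a ⊗ b)       F = DefinableMap a (proj₁ ∘ F) × DefinableMap b (proj₂ ∘ F)

  weaken : ∀ c {n} {F : Vector Carrier n → ⟦ c ⟧} → DefinableMap c F → DefinableMap c (F ∘ tail)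
  weaken pt            d       = weakenF d
  weaken (tup zero)    d       = tt
  weaken (tup (suc n)) (d , e) = weakenF d , weaken (tup n) e
  weaken (a ⊗ b)       (d , e) = weaken a d , weaken b e

  constant : ∀ c {n} (x : ⟦ c ⟧) → DefinableMap c {n} (λ _ → x)
  constant pt            x       = constF x
  constant (tup zero)    x       = tt
  constant (tup (suc n)) (x , y) = constF x , constant (tup n) y
  constant (a ⊗ b)       (x , y) = constant a x , constant b y

                                                                                           
  -- Definability is demanded after every substitution of definable maps for the argument. Closure
  -- under substitution, `_[_]`, is thus built in, and no substitution into formulas is needed.
  -- `Fun` follows the same pattern.
  record Def (c : Sort) (P : Pred ⟦ c ⟧ ℓ) : Set (ℓ ⊔ f ⊔ r) where
    constructor mkDef
    field
      instantiate : ∀ {n} (F : Vector Carrier n → ⟦ c ⟧) → DefinableMap c F → DefinablePred (P ∘ F)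
  open Def

  record Fun (c d : Sort) (g : ⟦ c ⟧ → ⟦ d ⟧) : Set (ℓ ⊔ f) where
    constructor mkFun
    field
      compose : ∀ {n} {F : Vector Carrier n → ⟦ c ⟧} → DefinableMap c F → DefinableMap d (g ∘ F)
  open Fun public

  π₁ : ∀ {a b} → Fun (a ⊗ b) a proj₁
  π₁ = mkFun proj₁

  π₂ : ∀ {a b} → Fun (a ⊗ b) b proj₂
  π₂ = mkFun proj₂

  headᶠ : ∀ {n} → Fun (tup (suc n)) pt proj₁
  headᶠ = mkFun proj₁

  tailᶠ : ∀ {n} → Fun (tup (suc n)) (tup n) proj₂
  tailᶠ = mkFun proj₂

  idᶠ : ∀ {a} → Fun a a (λ x → x)
  idᶠ = mkFun λ d → d

  fixᶠ : ∀ {c d} y → Fun c d (λ _ → y)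
  fixᶠ {d = d} y = mkFun λ _ → constant d y

  infixr 9 _∘ᶠ_
  _∘ᶠ_ : ∀ {a b c g h} → Fun b c g → Fun a b h → Fun a c (g ∘ h)
  g ∘ᶠ h = mkFun (compose g ∘ compose h)

  infixr 4 _,ᶠ_ _∷ᶠ_
  _,ᶠ_ : ∀ {a b c g h} → Fun c a g → Fun c b h → Fun c (a ⊗ b) (λ x → g x , h x)
  g ,ᶠ h = mkFun λ d → compose g d , compose h d

  _∷ᶠ_ : ∀ {c n g h} → Fun c pt g → Fun c (tup n) h → Fun c (tup (suc n)) (λ x → g x , h x)
  g ∷ᶠ h = mkFun λ d → compose g d , compose h d

  infixl 8 _[_]
  _[_] : ∀ {c d g P} → Def d P → Fun c d g → Def c (P ∘ g)
  p [ g ] = mkDef λ F d → instantiate p _ (compose g d)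

  fix₁ : ∀ {a c} {P : Pred ⟦ a ⊗ c ⟧ ℓ} → Def (a ⊗ c) P → ∀ x → Def c (λ y → P (x , y))
  fix₁ p x = p [ fixᶠ x ,ᶠ idᶠ ]

  fix₂ : ∀ {a c} {P : Pred ⟦ a ⊗ c ⟧ ℓ} → Def (a ⊗ c) P → ∀ y → Def a (λ x → P (x , y))
  fix₂ p y = p [ idᶠ ,ᶠ fixᶠ y ]

  def⇒definable : ∀ {D : Pred Carrier ℓ} → Def pt D → DefinableSet M D
  def⇒definable p = definablePred⇒definable (instantiate p (λ v → v 0F) (varF 0F))

  def⇒definableRel : ∀ {P : Pred ⟦ pt ⊗ pt ⟧ ℓ} → Def (pt ⊗ pt) P → DefinableRel M (λ x y → P (x , y))
  def⇒definableRel p = definablePred⇒definable (instantiate p (λ v → v 0F , v 1F) (varF 0F , varF 1F))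

  def-resp : ∀ {D : Pred Carrier ℓ} → Def pt D → ∀ {x y} → x ≈ y → D x → D y
  def-resp {D} p {x} {y} e =
    definablePred-resp {1} (instantiate p (λ v → v 0F) (varF 0F)) {λ _ → x} {λ _ → y} (λ _ → e)

  ∀ᵈ : ∀ {c} {P : Pred ⟦ pt ⊗ c ⟧ ℓ} → Def (pt ⊗ c) P → Def c (λ y → ∀ x → P (x , y))
  ∀ᵈ {c} p = mkDef λ F d → ∀D (instantiate p (λ w → w 0F , F (tail w)) (varF 0F , weaken c d))

  def-⇔ : ∀ {c} {P Q : Pred ⟦ c ⟧ ℓ} → (∀ x → P x ⇔ Q x) → Def c P → Def c Q
  def-⇔ eq p = mkDef λ F d → definablePred-⇔ (eq ∘ F) (instantiate p F d)

  curry-⇔ : ∀ {A B : Set ℓ} {P : A → B → Set ℓ} →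
            (∃[ y ] ∃[ x ] P x y) ⇔ (∃ λ ((x , y) : A × B) → P x y)
  curry-⇔ = mk⇔ (λ (y , x , h) → (x , y) , h) (λ ((x , y) , h) → y , x , h)

  -- A quantifier over a tuple or a product is unfolded into quantifiers over single elements, by
  -- induction on the sort.
  ∃ᵈ : ∀ a {c} {P : Pred ⟦ a ⊗ c ⟧ ℓ} → Def (a ⊗ c) P → Def c (λ y → ∃[ x ] P (x , y))
  ∃ᵈ pt {c} p = mkDef λ F d → ∃D (instantiate p (λ w → w 0F , F (tail w)) (varF 0F , weaken c d))
  ∃ᵈ (tup zero) p = def-⇔ (λ v → mk⇔ (tt ,_) proj₂) (p [ mkFun (tt ,_) ])
  ∃ᵈ (tup (suc n)) p = def-⇔ (λ v → curry-⇔)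
    (∃ᵈ (tup n) (∃ᵈ pt (p [ (π₁ ∷ᶠ π₁ ∘ᶠ π₂) ,ᶠ π₂ ∘ᶠ π₂ ])))
  ∃ᵈ (a ⊗ b) p = def-⇔ (λ v → curry-⇔)
    (∃ᵈ b (∃ᵈ a (p [ (π₁ ,ᶠ π₁ ∘ᶠ π₂) ,ᶠ π₂ ∘ᶠ π₂ ])))

  module _ {c : Sort} {P : Pred ⟦ c ⟧ ℓ} where
    infixr 6 _×ᵈ_
    infixr 5 _⊎ᵈ_

    _×ᵈ_ : ∀ {Q} → Def c P → Def c Q → Def c (λ x → P x × Q x)
    p ×ᵈ q = mkDef λ F d → ×D (instantiate p F d) (instantiate q F d)

    _⊎ᵈ_ : ∀ {Q} → Def c P → Def c Q → Def c (λ x → P x ⊎ Q x)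
    p ⊎ᵈ q = mkDef λ F d → ⊎D (instantiate p F d) (instantiate q F d)

    →ᵈ : ∀ {Q} → Def c P → Def c Q → Def c (λ x → P x → Q x)
    →ᵈ p q = mkDef λ F d → →D (instantiate p F d) (instantiate q F d)

    ¬ᵈ_ : Def c P → Def c (λ x → ¬ P x)
    -- The formula `⊥′` means the polymorphic `⊥`, whereas `¬_` targets the empty type at level
    -- zero; the equivalence mediates.
    ¬ᵈ p = def-⇔ (λ v → mk⇔ (λ h q → case-⊥ (h q)) (λ h q → ⊥-elim (h q)))
                 (→ᵈ p (mkDef λ _ _ → ⊥D))
      where
      case-⊥ : ∀ {p q} {A : Set q} → ⊥ {p} → A
      case-⊥ ()

  ≈ᵈ : ∀ {c s t} → Fun c pt s → Fun c pt t → Def c (λ x → s x ≈ t x)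
  ≈ᵈ s t = mkDef λ F d → ≈D (compose s d) (compose t d)

module _ (em : ∀ {a} → ExcludedMiddle a) where

  dne : ∀ {p} {P : Set p} → ¬ ¬ P → P
  dne {P = P} ¬¬p with em {P = P}
  ... | yes p = p
  ... | no ¬p = ⊥-elim (¬¬p ¬p)

  -- Invariance of pure-set definability under transpositions.

  module PureSet {ℓ} (S : Setoid ℓ ℓ) where
    open Setoid S

    -- The graph of the transposition of `x` and `y`. As a relation it needs excluded middle only
    -- where a value has to be produced, in `swap-total`.
    Swap : Carrier → Carrier → Carrier → Carrier → Set ℓ
    Swap x y z w = (z ≈ x × w ≈ y) ⊎ (z ≈ y × w ≈ x) ⊎ (¬ z ≈ x × ¬ z ≈ y × z ≈ w)

    module _ {x y : Carrier} (x≉y : ¬ x ≈ y) where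
      swap-total : ∀ z → ∃[ w ] Swap x y z w
      swap-total z with em {P = z ≈ x} | em {P = z ≈ y}
      ... | yes p | _     = y , inj₁ (p , refl)
      ... | no p  | yes q = x , inj₂ (inj₁ (q , refl))
      ... | no p  | no q  = z , inj₂ (inj₂ (p , q , refl))

      swap-sym : ∀ {z w} → Swap x y z w → Swap x y w z
      swap-sym (inj₁ (p , q))            = inj₂ (inj₁ (q , p))
      swap-sym (inj₂ (inj₁ (p , q)))     = inj₁ (q , p)
      swap-sym (inj₂ (inj₂ (p , q , e))) = inj₂ (inj₂ (p ∘ trans e , q ∘ trans e , sym e))

      swap-functional : ∀ {z w z′ w′} → Swap x y z w → Swap x y z′ w′ → z ≈ z′ → w ≈ w′
      swap-functional (inj₁ (p , q)) (inj₁ (p′ , q′)) e = trans q (sym q′)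
      swap-functional (inj₁ (p , q)) (inj₂ (inj₁ (p′ , q′))) e =
        ⊥-elim (x≉y (trans (sym p) (trans e p′)))
      swap-functional (inj₁ (p , q)) (inj₂ (inj₂ (p′ , q′ , _))) e = ⊥-elim (p′ (trans (sym e) p))
      swap-functional (inj₂ (inj₁ (p , q))) (inj₁ (p′ , q′)) e =
        ⊥-elim (x≉y (trans (sym p′) (trans (sym e) p)))
      swap-functional (inj₂ (inj₁ (p , q))) (inj₂ (inj₁ (p′ , q′))) e = trans q (sym q′)
      swap-functional (inj₂ (inj₁ (p , q))) (inj₂ (inj₂ (p′ , q′ , _))) e =
        ⊥-elim (q′ (trans (sym e) p))
      swap-functional (inj₂ (inj₂ (p , q , _))) (inj₁ (p′ , q′)) e = ⊥-elim (p (trans e p′))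
      swap-functional (inj₂ (inj₂ (p , q , _))) (inj₂ (inj₁ (p′ , q′))) e = ⊥-elim (q (trans e p′))
      swap-functional (inj₂ (inj₂ (p , q , d))) (inj₂ (inj₂ (p′ , q′ , d′))) e =
        trans (sym d) (trans e d′)

      swap-◂ : ∀ {n} {u v : Vector Carrier n} {z w} → Swap x y z w →
               (∀ i → Swap x y (u i) (v i)) → ∀ i → Swap x y ((z ◂ u) i) ((w ◂ v) i)
      swap-◂ s e zero    = s
      swap-◂ s e (suc i) = e i

      -- Automorphisms preserve all formulas. Equations need that the transposition is functional,
      -- implications that it is symmetric, quantifiers that it is total.
      satisfies-swap : ∀ {n} (φ : Formula emptySignature n) {u v : Vector Carrier n} →
                       (∀ i → Swap x y (u i) (v i)) →
                       Satisfies (pureSet S) φ u → Satisfies (pureSet S) φ v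
      satisfies-swap (var i ≐ var j) e p = swap-functional (e i) (e j) p
      satisfies-swap (φ ∧′ ψ) e (p , q)  = satisfies-swap φ e p , satisfies-swap ψ e q
      satisfies-swap (φ ∨′ ψ) e (inj₁ p) = inj₁ (satisfies-swap φ e p)
      satisfies-swap (φ ∨′ ψ) e (inj₂ p) = inj₂ (satisfies-swap ψ e p)
      satisfies-swap (φ ⇒′ ψ) e p        =
        satisfies-swap ψ e ∘ p ∘ satisfies-swap φ (swap-sym ∘ e)
      satisfies-swap (∀′ φ)   e p w      =
        let z , s = swap-total w in satisfies-swap φ (swap-◂ (swap-sym s) e) (p z)
      satisfies-swap (∃′ φ)   e (z , p)  =
        let w , s = swap-total z in w , satisfies-swap φ (swap-◂ s e) p

      -- Parameters other than `x` and `y` are fixed by the transposition, which exchanges the two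
      -- arguments.
      definable-swap : ∀ {m} (φ : Formula emptySignature (2 +ℕ m)) (a : Vector Carrier m) →
                       ¬ Any (x ≈_) (tabulate a) → ¬ Any (y ≈_) (tabulate a) →
                       Satisfies (pureSet S) φ ((x ◂ y ◂ λ ()) ++ a) →
                       Satisfies (pureSet S) φ ((y ◂ x ◂ λ ()) ++ a)
      definable-swap φ a x∉a y∉a = satisfies-swap φ λ where
        0F            → inj₁ (refl , refl)
        1F            → inj₂ (inj₁ (refl , refl))
        (suc (suc j)) → inj₂ (inj₂ ((λ e → x∉a (Any.tabulate⁺ j (sym e))) ,
                                    (λ e → y∉a (Any.tabulate⁺ j (sym e))) , refl))

  -- Polynomial functions over an infinite field.

  module InfiniteField {ℓ} (K : Field ℓ) (infinite : ¬ Finite (Field.setoid K) U) where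
    open Field K
    open import Algebra.Properties.Ring ring using (-‿distribˡ-*; -‿distribʳ-*; +-cancelˡ; x∙y⁻¹≈ε⇒x≈y)
    open import Algebra.Solver.Ring.NaturalCoefficients.Default commutativeSemiring
      using (solve; _:=_; _:+_; _:*_)
    open import Relation.Binary.Reasoning.Setoid setoid

    infix 4 _∈_ _∉_
    _∈_ _∉_ : Carrier → List Carrier → Set ℓ
    x ∈ xs = Any (x ≈_) xs
    x ∉ xs = ¬ (x ∈ xs)

    fresh : ∀ xs → ∃[ x ] x ∉ xs
    fresh xs with em {P = ∃[ x ] x ∉ xs}
    ... | yes p = p
    ... | no ¬p = ⊥-elim (infinite (xs , λ x _ → dne λ x∉ → ¬p (x , x∉)))

    infix 4 _∈*_
    -- Membership in the box of all tuples with entries from `xs`. Finiteness of a set of tuples is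
    -- expressed by containment in a box, which avoids an equality on tuples.
    _∈*_ : ∀ {n} → Tuple Carrier n → List Carrier → Set ℓ
    _∈*_ {zero}  t       xs = ⊤
    _∈*_ {suc n} (x , t) xs = x ∈ xs × t ∈* xs

    ∈*-mono : ∀ {n xs ys} {t : Tuple Carrier n} → (∀ {x} → x ∈ xs → x ∈ ys) → t ∈* xs → t ∈* ys
    ∈*-mono {zero}  sub h       = tt
    ∈*-mono {suc n} sub (h , k) = sub h , ∈*-mono sub k

    entries : ∀ {n} → Tuple Carrier n → List Carrier
    entries {zero}  _       = []
    entries {suc n} (x , t) = x ∷ entries t

    neg-cancel : ∀ x y → (x + y) + - y ≈ x
    neg-cancel x y = trans (+-assoc x y (- y)) (trans (+-congˡ (-‿inverseʳ y)) (+-identityʳ x))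

    x-y≈0⇒x≈y : ∀ {x y} → x + - y ≈ 0# → x ≈ y
    x-y≈0⇒x≈y = x∙y⁻¹≈ε⇒x≈y _ _

    x≈y⇒x-y≈0 : ∀ {x y} → x ≈ y → x + - y ≈ 0#
    x≈y⇒x-y≈0 {x} {y} e = trans (+-congʳ e) (-‿inverseʳ y)

    difference-cancel : ∀ u v w → ((u + v) + - (u + w)) + w ≈ v
    difference-cancel u v w = +-cancelˡ u _ _ (begin
      u + (((u + v) + - (u + w)) + w)
        ≈⟨ solve 4 (λ u v n w → u :+ (((u :+ v) :+ n) :+ w) := (u :+ v) :+ ((u :+ w) :+ n))
             refl u v (- (u + w)) w ⟩
      (u + v) + ((u + w) + - (u + w))
        ≈⟨ +-congˡ (-‿inverseʳ _) ⟩
      (u + v) + 0#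
        ≈⟨ +-identityʳ _ ⟩
      u + v ∎)

    *-cancel : ∀ {x y z} → ¬ x ≈ 0# → x * y ≈ x * z → y ≈ z
    *-cancel {x} {y} {z} x≉0 e = begin
      y            ≈⟨ expand y ⟩
      u * (x * y)  ≈⟨ *-congˡ e ⟩
      u * (x * z)  ≈⟨ expand z ⟨
      z            ∎
      where
      u = proj₁ (inverse x x≉0)
      expand : ∀ w → w ≈ u * (x * w)
      expand w = begin
        w            ≈⟨ *-identityˡ w ⟨
        1# * w       ≈⟨ *-congʳ (trans (sym (proj₂ (inverse x x≉0))) (*-comm x u)) ⟩
        u * x * w    ≈⟨ *-assoc u x w ⟩
        u * (x * w)  ∎

    x*y≈0⇒y≈0 : ∀ {x y} → ¬ x ≈ 0# → x * y ≈ 0# → y ≈ 0#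
    x*y≈0⇒y≈0 {x} x≉0 e = *-cancel x≉0 (trans e (sym (zeroʳ x)))

    -- The induction step of the factor theorem in Horner form, shared by `root-factor` over K and
    -- `evalˣ-factor` over K[X]/(f).
    horner-factor : ∀ {a b u v q} e → v ≈ u + (b + - a) * q →
                    e + b * v ≈ (e + a * u) + (b + - a) * (u + b * q)
    horner-factor {a} {b} {u} {v} {q} e eq = begin
      e + b * v                                          ≈⟨ +-congˡ (*-congˡ eq) ⟩
      e + b * (u + (b + - a) * q)                        ≈⟨ +-identityʳ _ ⟨
      -- The solver is one for semirings, so the cancelling pair `a`, `- a` is inserted by hand.
      e + b * (u + (b + - a) * q) + 0#                   ≈⟨ +-congˡ (trans (sym (zeroˡ u)) (*-congʳ (sym (-‿inverseʳ a)))) ⟩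
      e + b * (u + (b + - a) * q) + (a + - a) * u        ≈⟨ solve 6
        (λ e a a′ b u q → e :+ b :* (u :+ (b :+ a′) :* q) :+ (a :+ a′) :* u
                       := (e :+ a :* u) :+ (b :+ a′) :* (u :+ b :* q)) refl e a (- a) b u q ⟩
      (e + a * u) + (b + - a) * (u + b * q)              ∎

    -- Polynomials as tuples of coefficients, constant coefficient first, leading zeros allowed.
    eval : ∀ n → Tuple Carrier n → Carrier → Carrier
    eval zero    _       x = 0#
    eval (suc n) (a , t) x = a + x * eval n t x

    eval-0 : ∀ n a t → eval (suc n) (a , t) 0# ≈ a
    eval-0 n a t = trans (+-congˡ (zeroˡ _)) (+-identityʳ a)

    -- Polynomials of degree less than `n`, taken as functions. Since K is infinite, the function
    -- determines the coefficients; see `eval-injective`.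
    PF : ℕ → (Carrier → Carrier) → Set ℓ
    PF n F = ∃[ t ] ∀ x → F x ≈ eval n t x

    pf-resp : ∀ {n F G} → (∀ x → G x ≈ F x) → PF n F → PF n G
    pf-resp e (t , h) = t , λ x → trans (e x) (h x)

    pf-eval : ∀ n t → PF n (eval n t)
    pf-eval n t = t , λ x → refl

    pf-horner : ∀ {n F} a → PF n F → PF (suc n) (λ x → a + x * F x)
    pf-horner a (t , h) = (a , t) , λ x → +-congˡ (*-congˡ (h x))

    pf-shift : ∀ {n F} → PF n F → PF (suc n) (λ x → x * F x)
    pf-shift p = pf-resp (λ x → sym (+-identityˡ _)) (pf-horner 0# p)

    pf-zero : ∀ n → PF n (λ _ → 0#)
    pf-zero zero    = tt , λ _ → refl
    pf-zero (suc n) = pf-resp (λ x → sym (zeroʳ x)) (pf-shift (pf-zero n))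

    pf-const : ∀ n c → PF (suc n) (λ _ → c)
    pf-const n c = pf-resp (λ x → sym (trans (+-congˡ (zeroʳ x)) (+-identityʳ c))) (pf-horner c (pf-zero n))

    pf-suc : ∀ n {F} → PF n F → PF (suc n) F
    pf-suc zero    (tt , h)      = pf-resp h (pf-zero 1)
    pf-suc (suc n) ((a , t) , h) = pf-resp h (pf-horner a (pf-suc n (pf-eval n t)))

    pf-pad : ∀ {n} k {F} → PF n F → PF (k +ℕ n) F
    pf-pad zero    p = p
    pf-pad (suc k) p = pf-suc _ (pf-pad k p)

    pf-padʳ : ∀ {n} k {F} → PF n F → PF (n +ℕ k) F
    pf-padʳ {n} k {F} p = ≡.subst (λ m → PF m F) (ℕ.+-comm k n) (pf-pad k p)

    pf-+ : ∀ n {F G} → PF n F → PF n G → PF n (λ x → F x + G x)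
    pf-+ zero    (_ , h) (_ , g) = pf-resp (λ x → trans (+-cong (h x) (g x)) (+-identityˡ 0#)) (pf-zero 0)
    pf-+ (suc n) ((a , s) , h) ((b , t) , g) = pf-resp
      (λ x → trans (+-cong (h x) (g x)) (solve 5
        (λ a b x s t → (a :+ x :* s) :+ (b :+ x :* t) := (a :+ b) :+ x :* (s :+ t))
        refl a b x (eval n s x) (eval n t x)))
      (pf-horner (a + b) (pf-+ n (pf-eval n s) (pf-eval n t)))

    pf-scale : ∀ n c {F} → PF n F → PF n (λ x → c * F x)
    pf-scale zero    c (_ , h) = pf-resp (λ x → trans (*-congˡ (h x)) (zeroʳ c)) (pf-zero 0)
    pf-scale (suc n) c ((a , s) , h) = pf-resp
      (λ x → trans (*-congˡ (h x)) (solve 4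
        (λ c a x s → c :* (a :+ x :* s) := c :* a :+ x :* (c :* s)) refl c a x (eval n s x)))
      (pf-horner (c * a) (pf-scale n c (pf-eval n s)))

    pf-neg : ∀ n {F} → PF n F → PF n (λ x → - F x)
    pf-neg n {F} p = pf-resp
      (λ x → trans (-‿cong (sym (*-identityˡ (F x)))) (-‿distribˡ-* 1# (F x))) (pf-scale n (- 1#) p)

    pf-* : ∀ n {m F G} → PF n F → PF m G → PF (n +ℕ m) (λ x → F x * G x)
    pf-* zero    {m} {G = G} (_ , h) q = pf-resp (λ x → trans (*-congʳ (h x)) (zeroˡ (G x))) (pf-zero m)
    pf-* (suc n) {m} {G = G} ((a , s) , h) q = pf-resp
      (λ x → trans (*-congʳ (h x)) (solve 4
        (λ a x s g → (a :+ x :* s) :* g := a :* g :+ x :* (s :* g)) refl a x (eval n s x) (G x)))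
      (pf-+ (suc n +ℕ m) (pf-pad (suc n) (pf-scale m a q)) (pf-shift (pf-* n (pf-eval n s) q)))

    Poly : (Carrier → Carrier) → Set ℓ
    Poly F = ∃[ n ] PF n F

    poly-+ : ∀ {F G} → Poly F → Poly G → Poly (λ x → F x + G x)
    poly-+ (n , p) (m , q) = n +ℕ m , pf-+ (n +ℕ m) (pf-padʳ m p) (pf-pad n q)

    poly-* : ∀ {F G} → Poly F → Poly G → Poly (λ x → F x * G x)
    poly-* (n , p) (m , q) = n +ℕ m , pf-* n p q

    poly-neg : ∀ {F} → Poly F → Poly (λ x → - F x)
    poly-neg (n , p) = n , pf-neg n p

    poly-const : ∀ c → Poly (λ _ → c)
    poly-const c = 1 , pf-const 0 c

    -- A crude length for a composition. What matters is that it does not depend on the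
    -- coefficients, so that a formula can quantify over polynomials of this length.
    compose-length : ℕ → ℕ → ℕ
    compose-length zero    n = 0
    compose-length (suc k) n = suc (n +ℕ compose-length k n)

    pf-∘ : ∀ k {n} (e : Tuple Carrier k) {F} → PF n F →
           PF (compose-length k n) (λ x → eval k e (F x))
    pf-∘ zero        _       p = pf-zero 0
    pf-∘ (suc k) {n} (a , e) p =
      pf-+ _ (pf-const (n +ℕ compose-length k n) a) (pf-suc _ (pf-* n p (pf-∘ k e p)))

    -- Synthetic division by X - r: the coefficients of the quotient are the intermediate values of
    -- Horner's scheme at `r`.
    root-factor : ∀ n t r → ∃[ s ] ∀ x → eval (suc n) t x ≈ eval (suc n) t r + (x + - r) * eval n s x
    root-factor zero    (a , _) r = tt , λ x → begin
      a + x * 0#                          ≈⟨ +-congˡ (trans (zeroʳ x) (sym (zeroʳ r))) ⟩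
      a + r * 0#                          ≈⟨ +-identityʳ _ ⟨
      a + r * 0# + 0#                     ≈⟨ +-congˡ (zeroʳ _) ⟨
      a + r * 0# + (x + - r) * 0#         ∎
    root-factor (suc n) (a , t) r =
      let s , h = root-factor n t r in (eval (suc n) t r , s) , λ x → horner-factor a (h x)

    linear-factor : ∀ {y u v w} → u ≈ y + v * w → y ≈ 0# → u ≈ v * w
    linear-factor e y≈0 = trans e (trans (+-congʳ y≈0) (+-identityˡ _))

    poly-factor : ∀ {F} → Poly F → ∀ r → F r ≈ 0# → ∃[ G ] Poly G × (∀ x → F x ≈ (x + - r) * G x)
    poly-factor (n , p) r Fr≈0 =
      let t , h = pf-suc n p
          s , g = root-factor n t r
      in eval n s , (n , pf-eval n s) , λ x →
         trans (h x) (linear-factor (g x) (trans (sym (h r)) Fr≈0))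

    -- Splitting off one root leaves a quotient with fewer coefficients, which is still nonzero at
    -- the same `y`.
    roots-finite : ∀ n t → ∃[ y ] ¬ eval n t y ≈ 0# → ∃[ xs ] ∀ x → eval n t x ≈ 0# → x ∈ xs
    roots-finite zero    t (y , y≉0) = ⊥-elim (y≉0 refl)
    roots-finite (suc n) t (y , y≉0) with em {P = ∃[ r ] eval (suc n) t r ≈ 0#}
    ... | no ¬root     = [] , λ x e → ⊥-elim (¬root (x , e))
    ... | yes (r , tr≈0) =
      let s , h = root-factor n t r
          xs , g = roots-finite n s (y , λ sy≈0 →
            y≉0 (trans (linear-factor (h y) tr≈0) (trans (*-congˡ sy≈0) (zeroʳ _))))
      in r ∷ xs , λ x tx≈0 → case s xs h g x tx≈0
      where
      case : ∀ s xs → (∀ x → eval (suc n) t x ≈ eval (suc n) t r + (x + - r) * eval n s x) →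
             (∀ x → eval n s x ≈ 0# → x ∈ xs) → ∀ x → eval (suc n) t x ≈ 0# → x ∈ r ∷ xs
      case s xs h g x tx≈0 with em {P = x ≈ r}
      ... | yes x≈r = here x≈r
      ... | no x≉r  =
        there (g x (x*y≈0⇒y≈0 (x≉r ∘ x-y≈0⇒x≈y) (trans (sym (linear-factor (h x) tr≈0)) tx≈0)))

    -- A nonzero polynomial has only finitely many roots, while K is infinite. This recovers the
    -- value at `r` after a factor X - r has been cancelled pointwise away from `r`.
    poly-zero-off : ∀ {F} → Poly F → ∀ r → (∀ x → ¬ x ≈ r → F x ≈ 0#) → ∀ x → F x ≈ 0#
    poly-zero-off (n , t , h) r zero-off y = dne λ y≉0 →
      let xs , g = roots-finite n t (y , y≉0 ∘ trans (h y))
          z , z∉ = fresh (r ∷ xs)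
      in z∉ (there (g z (trans (sym (h z)) (zero-off z (z∉ ∘ here)))))

    poly-≈-off : ∀ {F G} → Poly F → Poly G → ∀ r → (∀ x → ¬ x ≈ r → F x ≈ G x) → ∀ x → F x ≈ G x
    poly-≈-off p q r off x = x-y≈0⇒x≈y
      (poly-zero-off (poly-+ p (poly-neg q)) r (λ x x≉r → x≈y⇒x-y≈0 (off x x≉r)) x)

    poly-cancel : ∀ {F G} → Poly F → Poly G → ∀ r →
                  (∀ x → (x + - r) * F x ≈ (x + - r) * G x) → ∀ x → F x ≈ G x
    poly-cancel p q r e = poly-≈-off p q r λ x x≉r → *-cancel (x≉r ∘ x-y≈0⇒x≈y) (e x)

    shift-cancel : ∀ {F G} → Poly F → Poly G → (∀ x → x * F x ≈ x * G x) → ∀ x → F x ≈ G x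
    shift-cancel p q e = poly-≈-off p q 0# λ x x≉0 → *-cancel x≉0 (e x)

    eval-≈⇒head-≈ : ∀ n m a b s t → (∀ x → eval (suc n) (a , s) x ≈ eval (suc m) (b , t) x) → a ≈ b
    eval-≈⇒head-≈ n m a b s t e = trans (sym (eval-0 n a s)) (trans (e 0#) (eval-0 m b t))

    -- Constant terms agree by evaluation at 0; removing them leaves a common factor X to cancel.
    eval-≈⇒tail-≈ : ∀ n m a b s t → (∀ x → eval (suc n) (a , s) x ≈ eval (suc m) (b , t) x) →
                    ∀ x → eval n s x ≈ eval m t x
    eval-≈⇒tail-≈ n m a b s t e = shift-cancel (n , pf-eval n s) (m , pf-eval m t) λ x →
      +-cancelˡ a _ _ (trans (e x) (+-congʳ (sym (eval-≈⇒head-≈ n m a b s t e))))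

    eval-injective : ∀ n s t → (∀ x → eval n s x ≈ eval n t x) → s ∈* entries t
    eval-injective zero    s       t       e = tt
    eval-injective (suc n) (a , s) (b , t) e =
      here (eval-≈⇒head-≈ n n a b s t e) ,
      ∈*-mono there (eval-injective n s t (eval-≈⇒tail-≈ n n a b s t e))

    -- Leading coefficients and division with remainder.

    infixr 8 _^_
    _^_ : Carrier → ℕ → Carrier
    x ^ zero  = 1#
    x ^ suc n = x * x ^ n

    ^-+ : ∀ x m n → x ^ (m +ℕ n) ≈ x ^ m * x ^ n
    ^-+ x zero    n = sym (*-identityˡ _)
    ^-+ x (suc m) n = trans (*-congˡ (^-+ x m n)) (sym (*-assoc x _ _))

    pf-^* : ∀ {n F} m → PF n F → PF (m +ℕ n) (λ x → x ^ m * F x)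
    pf-^* zero    p = pf-resp (λ x → *-identityˡ _) p
    pf-^* (suc m) p = pf-resp (λ x → *-assoc x _ _) (pf-shift (pf-^* m p))

    poly-^ : ∀ c n → Poly (λ x → c * x ^ n)
    poly-^ c n = n +ℕ 1 , pf-resp (λ x → *-comm c _) (pf-^* n (pf-const 0 c))

    -- Evaluation at 0 shows that the constant term of `F` vanishes, so a factor X cancels on both
    -- sides and `n` drops by one.
    leading-zero : ∀ n c {F} → PF n F → (∀ x → c * x ^ n ≈ F x) → c ≈ 0#
    leading-zero zero    c (_ , h) e = trans (sym (*-identityʳ c)) (trans (e 0#) (h 0#))
    leading-zero (suc n) c {F} ((a , t) , h) e = leading-zero n c (pf-eval n t)
      (shift-cancel (poly-^ c n) (n , pf-eval n t) λ x → begin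
        x * (c * x ^ n)        ≈⟨ x*cy≈c*xy x ⟩
        c * (x * x ^ n)        ≈⟨ trans (e x) (h x) ⟩
        a + x * eval n t x     ≈⟨ +-congʳ a≈0 ⟩
        0# + x * eval n t x    ≈⟨ +-identityˡ _ ⟩
        x * eval n t x         ∎)
      where
      x*cy≈c*xy : ∀ x → x * (c * x ^ n) ≈ c * (x * x ^ n)
      x*cy≈c*xy x = solve 3 (λ x c y → x :* (c :* y) := c :* (x :* y)) refl x c (x ^ n)

      a≈0 : a ≈ 0#
      a≈0 = begin
        a                       ≈⟨ eval-0 n a t ⟨
        a + 0# * eval n t 0#    ≈⟨ trans (e 0#) (h 0#) ⟨
        c * (0# * 0# ^ n)       ≈⟨ trans (*-congˡ (zeroˡ _)) (zeroʳ c) ⟩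
        0#                      ∎

    top : ∀ n → Tuple Carrier (suc n) → Carrier
    top zero    (a , _) = a
    top (suc n) (_ , t) = top n t

    init : ∀ n → Tuple Carrier (suc n) → Tuple Carrier n
    init zero    _       = tt
    init (suc n) (a , t) = a , init n t

    eval-top : ∀ n t x → eval (suc n) t x ≈ eval n (init n t) x + top n t * x ^ n
    eval-top zero    (a , _) x = trans (+-congˡ (zeroʳ x))
      (trans (+-comm a 0#) (+-congˡ (sym (*-identityʳ a))))
    eval-top (suc n) (a , t) x = trans (+-congˡ (*-congˡ (eval-top n t x)))
      (solve 5 (λ a x u c y → a :+ x :* (u :+ c :* y) := (a :+ x :* u) :+ c :* (x :* y))
        refl a x (eval n (init n t) x) (top n t) (x ^ n))

    toTuple : (as : List Carrier) → Tuple Carrier (length as)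
    toTuple []       = tt
    toTuple (a ∷ as) = a , toTuple as

    evalPoly-toTuple : ∀ as x → evalPoly K as x ≈ eval (length as) (toTuple as) x
    evalPoly-toTuple []       x = refl
    evalPoly-toTuple (a ∷ as) x = +-congˡ (*-congˡ (evalPoly-toTuple as x))

    eval≈0⇒coefficients≈0 : ∀ as → (∀ x → eval (length as) (toTuple as) x ≈ 0#) → ¬ Any (_≉ 0#) as
    eval≈0⇒coefficients≈0 (a ∷ as) e (here a≉0) = a≉0 (trans (sym (eval-0 _ a (toTuple as))) (e 0#))
    eval≈0⇒coefficients≈0 (a ∷ as) e (there p)  =
      eval≈0⇒coefficients≈0 as
        (eval-≈⇒tail-≈ (length as) 0 a 0# (toTuple as) tt λ x →
          trans (e x) (sym (trans (+-identityˡ _) (zeroʳ x)))) p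

    root-or-constant⇒root : ∀ p → NonConstant K p →
      (∃[ x ] eval (length p) (toTuple p) x ≈ 0#) ⊎ (∃[ c ] ∀ x → eval (length p) (toTuple p) x ≈ c) →
      ∃[ x ] evalPoly K p x ≈ 0#
    root-or-constant⇒root p        nc (inj₁ (x , e)) = x , trans (evalPoly-toTuple p x) e
    root-or-constant⇒root (a ∷ as) nc (inj₂ (c , e)) = ⊥-elim
      (eval≈0⇒coefficients≈0 as
        (eval-≈⇒tail-≈ (length as) 0 a c (toTuple as) tt λ x →
          trans (e x) (sym (trans (+-congˡ (zeroʳ x)) (+-identityʳ c)))) nc)

    -- By comparing leading coefficients.
    multiple-zero : ∀ d (f : Tuple Carrier (suc d)) → ¬ top d f ≈ 0# → ∀ {W} → PF d W →
      ∀ k h → (∀ x → eval (suc d) f x * eval k h x ≈ W x) → ∀ x → eval k h x ≈ 0#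
    multiple-zero d f φ≉0 p zero    h e x = refl
    multiple-zero d f φ≉0 {W} p (suc k) h e x =
      trans (h≈init x) (multiple-zero d f φ≉0 p k (init k h)
        (λ x → trans (*-congˡ (sym (h≈init x))) (e x)) x)
      where
      φ = top d f
      η = top k h
      I = eval d (init d f)
      J = eval k (init k h)

      -- `W` minus all of the product except its leading term `φ * η * x ^ (d +ℕ k)`; the degree
      -- stays below that of this term.
      lower : PF (d +ℕ k) (λ x → W x + - (I x * J x + (η * (x ^ k * I x) + φ * (x ^ d * J x))))
      lower = pf-+ (d +ℕ k) (pf-padʳ k p) (pf-neg (d +ℕ k) (pf-+ (d +ℕ k)
        (pf-* d (pf-eval d (init d f)) (pf-eval k (init k h)))
        (pf-+ (d +ℕ k)
          (pf-scale (d +ℕ k) η (≡.subst (λ m → PF m (λ x → x ^ k * I x)) (ℕ.+-comm k d)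
            (pf-^* k (pf-eval d (init d f)))))
          (pf-scale (d +ℕ k) φ (pf-^* d (pf-eval k (init k h)))))))

      expand : ∀ x → φ * η * x ^ (d +ℕ k) ≈
               W x + - (I x * J x + (η * (x ^ k * I x) + φ * (x ^ d * J x)))
      expand x = trans (sym (neg-cancel _ _)) (+-congʳ (begin
        φ * η * x ^ (d +ℕ k) + (I x * J x + (η * (x ^ k * I x) + φ * (x ^ d * J x)))
          ≈⟨ +-congʳ (*-congˡ (^-+ x d k)) ⟩
        φ * η * (x ^ d * x ^ k) + (I x * J x + (η * (x ^ k * I x) + φ * (x ^ d * J x)))
          ≈⟨ solve 6 (λ φ η i j u v → φ :* η :* (u :* v) :+ (i :* j :+ (η :* (v :* i) :+ φ :* (u :* j)))
                      := (i :+ φ :* u) :* (j :+ η :* v)) refl φ η (I x) (J x) (x ^ d) (x ^ k) ⟩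
        (I x + φ * x ^ d) * (J x + η * x ^ k)
          ≈⟨ *-cong (eval-top d f x) (eval-top k h x) ⟨
        eval (suc d) f x * eval (suc k) h x
          ≈⟨ e x ⟩
        W x ∎))

      η≈0 : η ≈ 0#
      η≈0 = x*y≈0⇒y≈0 φ≉0 (leading-zero (d +ℕ k) (φ * η) lower expand)

      h≈init : ∀ x → eval (suc k) h x ≈ J x
      h≈init x = trans (eval-top k h x)
        (trans (+-congˡ (trans (*-congʳ η≈0) (zeroˡ _))) (+-identityʳ _))

    -- Long division in Horner form: the division of `t` is multiplied by X, `a` is added to the
    -- remainder, and the resulting coefficient τ of X^d is removed by subtracting μ = τ / φ times
    -- f.
    divide : ∀ d (f : Tuple Carrier (suc d)) → ¬ top d f ≈ 0# → ∀ k {F} → PF k F →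
      ∃[ Z ] ∃[ H ] PF d Z × PF k H × (∀ x → F x ≈ Z x + eval (suc d) f x * H x)
    divide d f φ≉0 zero (_ , h) = (λ _ → 0#) , (λ _ → 0#) , pf-zero d , pf-zero 0 , λ x →
      trans (h x) (sym (trans (+-identityˡ _) (zeroʳ _)))
    divide d f φ≉0 (suc k) {F} ((a , t) , h) with divide d f φ≉0 k (pf-eval k t)
    ... | Z , H , (z , Z≈z) , H-pf , e =
        (λ x → I x + - μ * J x) , (λ x → μ + x * H x)
      , pf-+ d (pf-eval d (init d (a , z))) (pf-scale d (- μ) (pf-eval d (init d f)))
      , pf-horner μ H-pf , λ x → begin
        F x
          ≈⟨ h x ⟩
        a + x * eval k t x
          ≈⟨ +-congˡ (*-congˡ (trans (e x) (+-congʳ (Z≈z x)))) ⟩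
        a + x * (eval d z x + eval (suc d) f x * H x)
          ≈⟨ solve 5 (λ a x z f h → a :+ x :* (z :+ f :* h) := (a :+ x :* z) :+ f :* (x :* h))
               refl a x (eval d z x) (eval (suc d) f x) (H x) ⟩
        eval (suc d) (a , z) x + eval (suc d) f x * (x * H x)
          ≈⟨ +-cong (trans (eval-top d (a , z) x) (+-congˡ (*-congʳ τ≈μφ))) (*-congʳ (eval-top d f x)) ⟩
        (I x + μ * φ * x ^ d) + (J x + φ * x ^ d) * (x * H x)
          ≈⟨ +-identityʳ _ ⟨
        (I x + μ * φ * x ^ d) + (J x + φ * x ^ d) * (x * H x) + 0#
          ≈⟨ +-congˡ (trans (sym (zeroˡ (J x))) (*-congʳ (sym (-‿inverseʳ μ)))) ⟩
        (I x + μ * φ * x ^ d) + (J x + φ * x ^ d) * (x * H x) + (μ + - μ) * J x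
          ≈⟨ solve 7 (λ i m n p y j h → (i :+ m :* p :* y) :+ (j :+ p :* y) :* h :+ (m :+ n) :* j
                       := (i :+ n :* j) :+ (j :+ p :* y) :* (m :+ h))
               refl (I x) μ (- μ) φ (x ^ d) (J x) (x * H x) ⟩
        (I x + - μ * J x) + (J x + φ * x ^ d) * (μ + x * H x)
          ≈⟨ +-congˡ (*-congʳ (eval-top d f x)) ⟨
        (I x + - μ * J x) + eval (suc d) f x * (μ + x * H x) ∎
      where
      φ = top d f
      τ = top d (a , z)
      I = eval d (init d (a , z))
      J = eval d (init d f)
      μ = proj₁ (inverse φ φ≉0) * τ

      τ≈μφ : τ ≈ μ * φ
      τ≈μφ = begin
        τ                                ≈⟨ *-identityʳ τ ⟨
        τ * 1#                           ≈⟨ *-congˡ (proj₂ (inverse φ φ≉0)) ⟨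
        τ * (φ * proj₁ (inverse φ φ≉0))  ≈⟨ solve 3 (λ t p i → t :* (p :* i) := i :* t :* p)
                                              refl τ φ (proj₁ (inverse φ φ≉0)) ⟩
        μ * φ                            ∎

    -- Linear polynomials and the extension K[X]/(f).

    RootOrConstant : ℕ → Set ℓ
    RootOrConstant k = ∀ t → (∃[ x ] eval k t x ≈ 0#) ⊎ (∃[ c ] ∀ x → eval k t x ≈ c)

    root-or-constant-2 : RootOrConstant 2
    root-or-constant-2 (a , b , _) with em {P = b ≈ 0#}
    ... | yes b≈0 = inj₂ (a , λ x → begin
      a + x * (b + x * 0#)  ≈⟨ +-congˡ (*-congˡ (trans (+-cong b≈0 (zeroʳ x)) (+-identityˡ 0#))) ⟩
      a + x * 0#            ≈⟨ trans (+-congˡ (zeroʳ x)) (+-identityʳ a) ⟩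
      a                     ∎)
    ... | no b≉0  = inj₁ (- a * i , (begin
      a + - a * i * (b + - a * i * 0#)  ≈⟨ +-congˡ (*-congˡ (trans (+-congˡ (zeroʳ _)) (+-identityʳ b))) ⟩
      a + - a * i * b                   ≈⟨ +-congˡ (*-assoc _ i b) ⟩
      a + - a * (i * b)                 ≈⟨ +-congˡ (*-congˡ (trans (*-comm i b) (proj₂ (inverse b b≉0)))) ⟩
      a + - a * 1#                      ≈⟨ +-congˡ (*-identityʳ _) ⟩
      a + - a                           ≈⟨ -‿inverseʳ a ⟩
      0#                                ∎))
      where i = proj₁ (inverse b b≉0)

    -- K[X]/(f), represented by polynomial functions on K, with Div as equality to zero.
    module Extension d (f : Tuple Carrier (suc d)) (φ≉0 : ¬ top d f ≈ 0#)
                     (no-root : ∀ x → ¬ eval (suc d) f x ≈ 0#)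
                     (solvable : ∀ k → k ≤ d → RootOrConstant k) where

      f̂ : Carrier → Carrier
      f̂ = eval (suc d) f

      f̂-poly : Poly f̂
      f̂-poly = suc d , pf-eval (suc d) f

      Div : (Carrier → Carrier) → Set ℓ
      Div F = ∃[ H ] Poly H × (∀ x → F x ≈ f̂ x * H x)

      div-resp : ∀ {F G} → (∀ x → G x ≈ F x) → Div F → Div G
      div-resp e (H , p , h) = H , p , λ x → trans (e x) (h x)

      div-+ : ∀ {F G} → Div F → Div G → Div (λ x → F x + G x)
      div-+ (H , p , h) (J , q , g) = (λ x → H x + J x) , poly-+ p q , λ x →
        trans (+-cong (h x) (g x)) (sym (distribˡ _ _ _))

      div-*ˡ : ∀ {F G} → Poly F → Div G → Div (λ x → F x * G x)
      div-*ˡ {F} {G} p (J , q , g) = (λ x → F x * J x) , poly-* p q , λ x →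
        trans (*-congˡ (g x)) (solve 3 (λ f g h → f :* (g :* h) := g :* (f :* h)) refl (F x) (f̂ x) (J x))

      div-neg : ∀ {F} → Div F → Div (λ x → - F x)
      div-neg {F} (H , p , h) = (λ x → - H x) , poly-neg p , λ x →
        trans (-‿cong (h x)) (-‿distribʳ-* _ _)

      div-cancel : ∀ {F G} → Div (λ x → F x + G x) → Div G → Div F
      div-cancel p q = div-resp (λ x → sym (neg-cancel _ _)) (div-+ p (div-neg q))

      -- The cofactor vanishes by `multiple-zero`. Hence elements of K[X]/(f) have unique
      -- representatives of degree below `d`.
      div-low-degree : ∀ {W} → PF d W → Div W → ∀ x → W x ≈ 0#
      div-low-degree p (H , (k , t , h) , e) x = trans (e x) (trans (*-congˡ (trans (h x)
        (multiple-zero d f φ≉0 p k t (λ x → sym (trans (e x) (*-congˡ (h x)))) x))) (zeroʳ _))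

      -- A linear factor X − r of P divides the cofactor of f, since f r ≉ 0, and can be cancelled.
      prime : ∀ k → k ≤ d → ∀ t → ∃[ y ] ¬ eval k t y ≈ 0# → ∀ {G} → Poly G →
              Div (λ x → eval k t x * G x) → Div G
      prime zero    k≤d t (y , y≉0) G-poly div = ⊥-elim (y≉0 refl)
      prime (suc k) k≤d t (y , y≉0) {G} G-poly (H , H-poly , e) with solvable (suc k) k≤d t
      ... | inj₂ (c , t≈c) = (λ x → i * H x) , poly-* (poly-const i) H-poly , λ x → begin
          G x                          ≈⟨ *-identityˡ _ ⟨
          1# * G x                     ≈⟨ *-congʳ (trans (sym (proj₂ (inverse c c≉0))) (*-comm c i)) ⟩
          i * c * G x                  ≈⟨ *-assoc i c _ ⟩
          i * (c * G x)                ≈⟨ *-congˡ (*-congʳ (t≈c x)) ⟨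
          i * (eval (suc k) t x * G x) ≈⟨ *-congˡ (e x) ⟩
          i * (f̂ x * H x)              ≈⟨ solve 3 (λ i f h → i :* (f :* h) := f :* (i :* h)) refl i (f̂ x) (H x) ⟩
          f̂ x * (i * H x)              ∎
        where
        c≉0 : ¬ c ≈ 0#
        c≉0 c≈0 = y≉0 (trans (t≈c y) c≈0)
        i = proj₁ (inverse c c≉0)
      ... | inj₁ (r , tr≈0) =
        let s , h = root-factor k t r
            t≈ = λ x → linear-factor (h x) tr≈0
            Hr≈0 = x*y≈0⇒y≈0 (no-root r) (trans (sym (e r)) (trans (*-congʳ tr≈0) (zeroˡ _)))
            J , J-poly , H≈ = poly-factor H-poly r Hr≈0
        in prime k (ℕ.≤-trans (ℕ.n≤1+n k) k≤d) s
             (y , λ sy≈0 → y≉0 (trans (t≈ y) (trans (*-congˡ sy≈0) (zeroʳ _)))) G-poly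
             (J , J-poly , poly-cancel (poly-* (k , pf-eval k s) G-poly) (poly-* f̂-poly J-poly) r (λ x → begin
               (x + - r) * (eval k s x * G x)  ≈⟨ *-assoc _ _ _ ⟨
               (x + - r) * eval k s x * G x    ≈⟨ *-congʳ (t≈ x) ⟨
               eval (suc k) t x * G x          ≈⟨ e x ⟩
               f̂ x * H x                       ≈⟨ *-congˡ (H≈ x) ⟩
               f̂ x * ((x + - r) * J x)         ≈⟨ solve 3 (λ f v j → f :* (v :* j) := v :* (f :* j))
                                                    refl (f̂ x) (x + - r) (J x) ⟩
               (x + - r) * (f̂ x * J x)         ∎))

      -- Polynomials over K[X]/(f); the value at α is again a polynomial function on K.
      evalˣ : ∀ {n} → Vec (Carrier → Carrier) n → (Carrier → Carrier) → Carrier → Carrier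
      evalˣ []       α x = 0#
      evalˣ (E ∷ Es) α x = E x + α x * evalˣ Es α x

      -- The quotient by Y - α; as in `root-factor`, its coefficients are Horner values at `α`.
      quotient : ∀ {n} → Vec (Carrier → Carrier) (suc n) → (Carrier → Carrier) → Vec (Carrier → Carrier) n
      quotient (E ∷ [])          α = []
      quotient (E ∷ Es@(_ ∷ _)) α = evalˣ Es α ∷ quotient Es α

      module _ {α : Carrier → Carrier} (α-poly : Poly α) where

        evalˣ-poly : ∀ {n} {Es : Vec _ n} → Allᵛ Poly Es → Poly (evalˣ Es α)
        evalˣ-poly []       = 0 , pf-zero 0
        evalˣ-poly (p ∷ ps) = poly-+ p (poly-* α-poly (evalˣ-poly ps))

        quotient-poly : ∀ {n} {Es : Vec _ (suc n)} → Allᵛ Poly Es → Allᵛ Poly (quotient Es α)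
        quotient-poly (p ∷ [])         = []
        quotient-poly (p ∷ ps@(_ ∷ _)) = evalˣ-poly ps ∷ quotient-poly ps

        evalˣ-div : ∀ {n} {Es : Vec _ n} → Allᵛ Div Es → Div (evalˣ Es α)
        evalˣ-div []       = (λ _ → 0#) , poly-const 0# , λ x → sym (zeroʳ _)
        evalˣ-div (p ∷ ps) = div-+ p (div-*ˡ α-poly (evalˣ-div ps))

        -- Dividing a nonzero polynomial by Y - α leaves a nonzero quotient. The first coefficient
        -- of the quotient is the value of the tail at `α`, so the tail vanishes by induction, and
        -- then `E` does too.
        coefficients-div : ∀ {n} E (Es : Vec _ n) → Div (evalˣ (E ∷ Es) α) →
                           Allᵛ Div (quotient (E ∷ Es) α) → Allᵛ Div (E ∷ Es)
        coefficients-div E []            root _        = div-cancel root (div-*ˡ α-poly (evalˣ-div [])) ∷ []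
        coefficients-div E (E′ ∷ Es) root (p ∷ ps) =
          let ih = coefficients-div E′ Es p ps
          in div-cancel root (div-*ˡ α-poly (evalˣ-div ih)) ∷ ih

      evalˣ-factor : ∀ {n} E (Es : Vec _ n) α β x →
        evalˣ (E ∷ Es) β x ≈ evalˣ (E ∷ Es) α x + (β x + - α x) * evalˣ (quotient (E ∷ Es) α) β x
      evalˣ-factor E []        α β x = sym (trans (+-congˡ (zeroʳ _)) (trans (+-identityʳ _)
        (+-congˡ (trans (zeroʳ _) (sym (zeroʳ _))))))
      evalˣ-factor E (E′ ∷ Es) α β x = horner-factor (E x) (evalˣ-factor E′ Es α β x)

      -- As in `roots-finite`, one root `a` is split off. For any other root `b`, the difference b -
      -- a is nonzero of degree below `d`, so `prime` cancels it and leaves `b` as a root of the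
      -- quotient.
      rootsˣ-finite : ∀ {n} (Es : Vec _ n) → Allᵛ Poly Es → ¬ Allᵛ Div Es →
                      ∃[ xs ] ∀ a → Div (evalˣ Es (eval d a)) → a ∈* xs
      rootsˣ-finite []       ps        ¬div = ⊥-elim (¬div [])
      rootsˣ-finite (E ∷ Es) ps ¬div with em {P = ∃[ a ] Div (evalˣ (E ∷ Es) (eval d a))}
      ... | no ¬root = [] , λ a root → ⊥-elim (¬root (a , root))
      ... | yes (a , root) =
        let α-poly = d , pf-eval d a
            xs , h = rootsˣ-finite (quotient (E ∷ Es) (eval d a)) (quotient-poly α-poly ps)
                       (λ div → ¬div (coefficients-div α-poly E Es root div))
        in entries a ⧺ xs , λ b root′ → case xs h b root′
        where
        case : ∀ xs → (∀ b → Div (evalˣ (quotient (E ∷ Es) (eval d a)) (eval d b)) → b ∈* xs) →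
               ∀ b → Div (evalˣ (E ∷ Es) (eval d b)) → b ∈* entries a ⧺ xs
        case xs h b root′ with em {P = ∃[ y ] ¬ (eval d b y + - eval d a y) ≈ 0#}
        ... | no b≡a = ∈*-mono Any.++⁺ˡ (eval-injective d b a λ x →
          x-y≈0⇒x≈y (dne λ ne → b≡a (x , ne)))
        ... | yes (y , y≉0) =
          let t , t≈ = pf-+ d (pf-eval d b) (pf-neg d (pf-eval d a))
          in ∈*-mono (Any.++⁺ʳ (entries a)) (h b (prime d ℕ.≤-refl t
               (y , y≉0 ∘ trans (t≈ y))
               (evalˣ-poly (d , pf-eval d b) (quotient-poly (d , pf-eval d a) ps))
               (div-resp (λ x → trans (*-congʳ (sym (t≈ x))) (trans (sym (neg-cancel _ _))
                   (+-congʳ (trans (+-comm _ _) (sym (evalˣ-factor E Es (eval d a) (eval d b) x))))))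
                 (div-+ root′ (div-neg root)))))

      constants : ∀ {k} → Tuple Carrier k → Vec (Carrier → Carrier) k
      constants {zero}  _       = []
      constants {suc k} (a , e) = (λ _ → a) ∷ constants e

      constants-poly : ∀ {k} (e : Tuple Carrier k) → Allᵛ Poly (constants e)
      constants-poly {zero}  _       = []
      constants-poly {suc k} (a , e) = poly-const a ∷ constants-poly e

      evalˣ-constants : ∀ {k} (e : Tuple Carrier k) α x → evalˣ (constants e) α x ≈ eval k e (α x)
      evalˣ-constants {zero}  _       α x = refl
      evalˣ-constants {suc k} (a , e) α x = +-congˡ (*-congˡ (evalˣ-constants e α x))

      -- K embeds in K[X]/(f), since constants have degree below `d`.
      constants-div⇒zero : ∀ {k} (e : Tuple Carrier k) → 1 ≤ d → Allᵛ Div (constants e) → ∀ x → eval k e x ≈ 0#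
      constants-div⇒zero {zero}  e       1≤d []       x = refl
      constants-div⇒zero {suc k} (a , e) 1≤d (p ∷ ps) x =
        trans (+-cong (div-low-degree (pf-≤ 1≤d) p x)
                      (trans (*-congˡ (constants-div⇒zero e 1≤d ps x)) (zeroʳ x)))
              (+-identityˡ 0#)
        where
        pf-≤ : ∀ {d} → 1 ≤ d → PF d (λ _ → a)
        pf-≤ (s≤s _) = pf-const _ a

      -- That f divides e(a(X)) means that the class of `a` is a root of `e` in K[X]/(f).
      composition-roots-finite : ∀ {k} (e : Tuple Carrier k) → 1 ≤ d → ∃[ y ] ¬ eval k e y ≈ 0# →
        ∃[ xs ] ∀ a → Div (λ x → eval k e (eval d a x)) → a ∈* xs
      composition-roots-finite e 1≤d (y , y≉0) =
        let xs , h = rootsˣ-finite (constants e) (constants-poly e)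
                       (λ div → y≉0 (constants-div⇒zero e 1≤d div y))
        in xs , λ a div → h a (div-resp (evalˣ-constants e (eval d a)) div)

    -- Products of linear factors and rescaling.

    product : ∀ n → Tuple Carrier n → Carrier → Carrier
    product zero    _       x = 1#
    product (suc n) (r , t) x = (x + - r) * product n t x

    pf-product : ∀ n t → PF (suc n) (product n t)
    pf-product zero    t       = pf-const 0 1#
    pf-product (suc n) (r , t) = pf-resp
      (λ x → trans (distribʳ _ x (- r)) (+-comm _ _))
      (pf-+ (suc (suc n)) (pf-suc _ (pf-scale (suc n) (- r) (pf-product n t))) (pf-shift (pf-product n t)))

    product≉0 : ∀ n t {x} → x ∉ entries t → ¬ product n t x ≈ 0#
    product≉0 zero    t       x∉ e = 0≉1 (sym e)
    product≉0 (suc n) (r , t) x∉ e =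
      product≉0 n t (x∉ ∘ there) (x*y≈0⇒y≈0 (x∉ ∘ here ∘ x-y≈0⇒x≈y) e)

    product-roots : ∀ n t xs → (∀ x → product n t x ≈ 0# → x ∈ xs) → t ∈* xs
    product-roots zero    t       xs h = tt
    product-roots (suc n) (r , t) xs h =
      h r (trans (*-congʳ (-‿inverseʳ r)) (zeroˡ _)) ,
      product-roots n t xs (λ x e → h x (trans (*-congˡ e) (zeroʳ _)))

    horner-scale : ∀ μ b x {u v} → u ≈ μ * v → μ * b + x * u ≈ μ * (b + x * v)
    horner-scale μ b x {u} {v} e = trans (+-congˡ (*-congˡ e))
      (solve 4 (λ m b x v → m :* b :+ x :* (m :* v) := m :* (b :+ x :* v)) refl μ b x v)

    -- With a nonzero coefficient `a` of `t`, the scalar μ = c / a works. A polynomial known only up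
    -- to a scalar thus absorbs one more coordinate `c`, which can be read off from it up to
    -- finitely many choices.
    rescale : ∀ n t → ∃[ y ] ¬ eval n t y ≈ 0# → ∀ {c} → ¬ c ≈ 0# →
              ∃[ μ ] ¬ μ ≈ 0# × (∃[ s ] c ∈ entries s × (∀ x → eval n s x ≈ μ * eval n t x))
    rescale n t (y , y≉0) {c} c≉0 =
      let a , a∈ , a≉0 = nonzero-entry n t y≉0
          i , ai≈1 = inverse a a≉0
          s , c∈ = scaled n t (c * i) a∈
      in c * i
       , (λ e → c≉0 (trans (sym (*-identityʳ c)) (trans (*-congˡ (trans (sym ai≈1) (*-comm a i)))
                (trans (sym (*-assoc c i a)) (trans (*-congʳ e) (zeroˡ a))))))
       , s , Any.map (trans (trans (sym (*-identityʳ c)) (trans (*-congˡ (trans (sym ai≈1) (*-comm a i)))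
                (sym (*-assoc c i a))))) (proj₁ c∈) , proj₂ c∈
      where
      nonzero-entry : ∀ n t {y} → ¬ eval n t y ≈ 0# → ∃[ a ] a ∈ entries t × ¬ a ≈ 0#
      nonzero-entry zero    t       y≉0 = ⊥-elim (y≉0 refl)
      nonzero-entry (suc n) (a , t) {y} y≉0 with em {P = a ≈ 0#}
      ... | no a≉0  = a , here refl , a≉0
      ... | yes a≈0 =
        let b , b∈ , b≉0 = nonzero-entry n t (λ e → y≉0 (trans (+-cong a≈0 (trans (*-congˡ e) (zeroʳ y))) (+-identityˡ 0#)))
        in b , there b∈ , b≉0

      scaled : ∀ n t μ {a} → a ∈ entries t →
               ∃[ s ] μ * a ∈ entries s × (∀ x → eval n s x ≈ μ * eval n t x)
      scaled (suc n) (b , t) μ (here e)  =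
        let s , h = pf-scale n μ (pf-eval n t) in
        (μ * b , s) , here (*-congˡ e) , λ x → horner-scale μ b x (sym (h x))
      scaled (suc n) (b , t) μ (there p) =
        let s , q , h = scaled n t μ p in
        (μ * b , s) , there q , λ x → horner-scale μ b x (h x)

  -- Definability in a minimal field and the quantifier `Q`.

  module MinimalField {ℓ f r} (K : Field ℓ) (L : Signature f r) (A : Structure L (Field.setoid K))
                      (minimal : Minimal (expansion K A)) where
    open Field K
    open Definability (expansion K A)
    open InfiniteField K (proj₁ minimal)

    module _ {c : Sort} {s t : ⟦ c ⟧ → Carrier} where
      infixl 6 _+ᶠ_
      infixl 7 _*ᶠ_

      _+ᶠ_ : Fun c pt s → Fun c pt t → Fun c pt (λ x → s x + t x)
      s-fun +ᶠ t-fun = mkFun λ d →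
        let ps , F = compose s-fun d
            qs , G = compose t-fun d
        in ps ⧺ qs , λ b b⊇ →
          let u , h = F b (All.++⁻ˡ ps b⊇)
              w , g = G b (All.++⁻ʳ ps b⊇)
          in func (inj₁ add) (u ◂ w ◂ λ ()) , λ v → +-cong (h v) (g v)

      _*ᶠ_ : Fun c pt s → Fun c pt t → Fun c pt (λ x → s x * t x)
      s-fun *ᶠ t-fun = mkFun λ d →
        let ps , F = compose s-fun d
            qs , G = compose t-fun d
        in ps ⧺ qs , λ b b⊇ →
          let u , h = F b (All.++⁻ˡ ps b⊇)
              w , g = G b (All.++⁻ʳ ps b⊇)
          in func (inj₁ mul) (u ◂ w ◂ λ ()) , λ v → *-cong (h v) (g v)

    -ᶠ_ : ∀ {c} {s : ⟦ c ⟧ → Carrier} → Fun c pt s → Fun c pt (λ x → - s x)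
    -ᶠ s-fun = mkFun λ d →
      let ps , F = compose s-fun d
      in ps , λ b b⊇ →
        let u , h = F b b⊇ in func (inj₁ neg) (u ◂ λ ()) , λ v → -‿cong (h v)

    evalᶠ : ∀ {c} n {t s} → Fun c (tup n) t → Fun c pt s → Fun c pt (λ y → eval n (t y) (s y))
    evalᶠ zero    t s = fixᶠ 0#
    evalᶠ (suc n) t s = (headᶠ ∘ᶠ t) +ᶠ (s *ᶠ evalᶠ n (tailᶠ ∘ᶠ t) s)

    productᶠ : ∀ {c} n {t s} → Fun c (tup n) t → Fun c pt s → Fun c pt (λ y → product n (t y) (s y))
    productᶠ zero    t s = fixᶠ 1#
    productᶠ (suc n) t s = (s +ᶠ (-ᶠ (headᶠ ∘ᶠ t))) *ᶠ productᶠ n (tailᶠ ∘ᶠ t) s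

    ∈-entriesᵈ : ∀ {c} n {s t} → Fun c pt s → Fun c (tup n) t → Def c (λ y → s y ∈ entries (t y))
    ∈-entriesᵈ zero    s t = def-⇔ (λ y → mk⇔ (λ ne → ⊥-elim (ne refl)) (λ ())) (¬ᵈ (≈ᵈ s s))
    ∈-entriesᵈ (suc n) s t = def-⇔ (λ y → mk⇔ Any.fromSum Any.toSum)
      (≈ᵈ s (headᶠ ∘ᶠ t) ⊎ᵈ ∈-entriesᵈ n s (tailᶠ ∘ᶠ t))

    Q : ∀ {p} → Pred Carrier p → Set (ℓ ⊔ p)
    Q = Cofinite setoid

    Q-∉ : ∀ xs → Q (_∉ xs)
    Q-∉ xs = xs , λ _ → dne

    Q-≉ : ∀ x → Q (λ y → ¬ y ≈ x)
    Q-≉ x = x ∷ [] , λ _ h → here (dne h)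

    module _ {p} {D : Pred Carrier p} where
      Q-all : (∀ x → D x) → Q D
      Q-all h = [] , λ x ¬d → ⊥-elim (¬d (h x))

      Q-∃ : Q D → ∃ D
      Q-∃ (xs , h) = let x , x∉ = fresh xs in x , dne (x∉ ∘ h x)

      finite⇒Q¬ : Finite setoid D → Q (λ x → ¬ D x)
      finite⇒Q¬ (xs , h) = xs , λ x ¬¬d → h x (dne ¬¬d)

      Q-mono : ∀ {q} {E : Pred Carrier q} → (∀ x → D x → E x) → Q D → Q E
      Q-mono sub (xs , h) = xs , λ x ¬e → h x (¬e ∘ sub x)

      Q-× : ∀ {q} {E : Pred Carrier q} → Q D → Q E → Q (λ x → D x × E x)
      Q-× (xs , h) (ys , g) = xs ⧺ ys , λ x ¬de → case x ¬de em
        where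
        case : ∀ x → ¬ (D x × _) → _ → x ∈ xs ⧺ ys
        case x ¬de (no ¬d) = Any.++⁺ˡ (h x ¬d)
        case x ¬de (yes d) = Any.++⁺ʳ xs (g x λ e → ¬de (d , e))

    Q⇒¬Q¬ : ∀ {p} {D : Pred Carrier p} → Q D → ¬ Q (λ x → ¬ D x)
    Q⇒¬Q¬ q q′ = let _ , d , ¬d = Q-∃ (Q-× q q′) in ¬d d

    ¬Q⇒finite : ∀ {D} → Def pt D → ¬ Q D → Finite setoid D
    ¬Q⇒finite {D} D-def ¬q with proj₂ minimal D (def⇒definable D-def)
    ... | inj₁ fin = fin
    ... | inj₂ q   = ⊥-elim (¬q q)

    -- Together with `Q⇒¬Q¬`, minimality makes `Q` an ultrafilter on the definable sets.
    ¬Q⇒Q¬ : ∀ {D} → Def pt D → ¬ Q D → Q (λ x → ¬ D x)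
    ¬Q⇒Q¬ D-def = finite⇒Q¬ ∘ ¬Q⇒finite D-def

    -- A cofinite set and a suitable translate of it cover K, two finite sets do not.
    cofinite⇔cover : ∀ {D} → Def pt D → Q D ⇔ (∃[ a ] ∀ x → D x ⊎ D (x + a))
    cofinite⇔cover {D} D-def = mk⇔ cover (λ (a , h) → dne (uncover a h))
      where
      cover : Q D → ∃[ a ] ∀ x → D x ⊎ D (x + a)
      cover (xs , h) = a , case
        where
        -- If neither `x` nor `x + a` is in D, then both are in `xs` and `a` is one of these
        -- differences.
        differences = concatMap (λ x → map (λ y → y + - x) xs) xs
        a = proj₁ (fresh differences)

        case : ∀ x → D x ⊎ D (x + a)
        case x with em {P = D x} | em {P = D (x + a)}
        ... | yes d | _     = inj₁ d
        ... | no _  | yes d = inj₂ d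
        ... | no ¬d | no ¬e = ⊥-elim (proj₂ (fresh differences)
          (Any.concatMap⁺ _ (Any.map
            (λ x≈x′ → Any.map⁺ (Any.map
              (λ x+a≈y → sym (trans (+-cong (trans (sym x+a≈y) (+-comm x a)) (-‿cong (sym x≈x′)))
                                    (neg-cancel a x)))
              (h (x + a) ¬e)))
            (h x ¬d))))

      uncover : ∀ a → (∀ x → D x ⊎ D (x + a)) → ¬ ¬ Q D
      uncover a h ¬q = proj₁ minimal (xs ⧺ map (λ y → y + - a) xs , λ x _ → case x (h x))
        where
        fin = ¬Q⇒finite D-def ¬q
        xs = proj₁ fin

        case : ∀ x → D x ⊎ D (x + a) → x ∈ xs ⧺ map (λ y → y + - a) xs
        case x (inj₁ d) = Any.++⁺ˡ (proj₂ fin x d)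
        case x (inj₂ d) = Any.++⁺ʳ xs (Any.map⁺ (Any.map
          (λ x+a≈y → trans (sym (neg-cancel x a)) (+-congʳ x+a≈y)) (proj₂ fin (x + a) d)))

    -- Cofiniteness is not first-order as it stands, but the covering criterion is, uniformly in
    -- `y`.
    Qᵈ : ∀ {c} {P : Pred ⟦ pt ⊗ c ⟧ ℓ} → Def (pt ⊗ c) P → Def c (λ y → Q (λ x → P (x , y)))
    Qᵈ p = def-⇔ (λ y → mk⇔ (from (cofinite⇔cover (fix₂ p y))) (to (cofinite⇔cover (fix₂ p y))))
      (∃ᵈ pt (∀ᵈ (p [ π₁ ,ᶠ π₂ ∘ᶠ π₂ ] ⊎ᵈ p [ (π₁ +ᶠ (π₁ ∘ᶠ π₂)) ,ᶠ π₂ ∘ᶠ π₂ ])))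

    -- Commutation of `Q` with itself in the unordered case.

    module _ (unordered : Unordered (expansion K A)) where

      module Asymmetric {P : Pred (Carrier × Carrier) ℓ} (p : Def (pt ⊗ pt) P)
                        (P-large : Q (λ x → Q (λ y → P (x , y))))
                        (C-large : Q (λ u → ¬ Q (λ x → P (x , u)))) where

        -- The set of `u` with ¬ P (x , u), restricted to those `u` for which this holds at almost
        -- all `x`. The order is strict inclusion of these sets.
        G : Carrier → Carrier → Set ℓ
        G x u = ¬ Q (λ x → P (x , u)) × ¬ P (x , u)

        _<_ : Carrier → Carrier → Set ℓ
        x < y = (∀ u → G x u → G y u) × (∃[ u ] G y u × ¬ G x u)

        G-def : Def (pt ⊗ pt) (λ (x , u) → G x u)
        G-def = ¬ᵈ (Qᵈ p [ π₂ ]) ×ᵈ ¬ᵈ p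

        <-def : Def (pt ⊗ pt) (λ (x , y) → x < y)
        <-def = ∀ᵈ (→ᵈ (G-def [ π₁ ∘ᶠ π₂ ,ᶠ π₁ ]) (G-def [ π₂ ∘ᶠ π₂ ,ᶠ π₁ ]))
             ×ᵈ ∃ᵈ pt (G-def [ π₂ ∘ᶠ π₂ ,ᶠ π₁ ] ×ᵈ ¬ᵈ (G-def [ π₁ ∘ᶠ π₂ ,ᶠ π₁ ]))

        G-resp : ∀ {x y} u → x ≈ y → G x u → G y u
        G-resp u e = def-resp (fix₂ G-def u) e

        <-isStrictPartialOrder : IsStrictPartialOrder _≈_ _<_
        <-isStrictPartialOrder = record
          { isEquivalence = isEquivalence
          ; irrefl        = λ e (_ , u , gy , ¬gx) → ¬gx (G-resp u (sym e) gy)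
          ; trans         = λ (s , u , gy , ¬gx) (t , _) → (λ v → t v ∘ s v) , u , t u gy , ¬gx
          ; <-resp-≈      =
              (λ e (s , u , gy , ¬gx) → (λ v → G-resp v e ∘ s v) , u , G-resp u e gy , ¬gx)
            , (λ e (s , u , gy , ¬gx) →
                (λ v → s v ∘ G-resp v (sym e)) , u , gy , ¬gx ∘ G-resp u (sym e))
          }

        -- For almost all x the set G x is finite and every u in it lies in almost all G y.
        <-large : ∀ {x} → Q (λ y → P (x , y)) → Q (λ y → x < y)
        <-large {x} q@(xs , h) =
          -- The inclusion is strict because of `u`, which lies in almost all G y but not in G x.
          let u , c , pxu = Q-∃ (Q-× C-large q) in
          Q-mono (λ y (all , ¬pyu) → (λ v (c , ¬pxv) → c , upward y all c (h v ¬pxv))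
                                   , u , (c , ¬pyu) , λ (_ , ¬pxu) → ¬pxu pxu)
                 (Q-× (almost-all xs) (¬Q⇒Q¬ (fix₂ p u) c))
          where
          Upward : Carrier → Carrier → Set ℓ
          Upward y u = ¬ Q (λ x → P (x , u)) → ¬ P (y , u)

          almost-all : ∀ us → Q (λ y → All (Upward y) us)
          almost-all []       = Q-all λ _ → []
          almost-all (u ∷ us) with em {P = ¬ Q (λ x → P (x , u))}
          ... | yes c = Q-mono (λ y (¬pyu , all) → (λ _ → ¬pyu) ∷ all)
                               (Q-× (¬Q⇒Q¬ (fix₂ p u) c) (almost-all us))
          ... | no ¬c = Q-mono (λ y all → (λ c → ⊥-elim (¬c c)) ∷ all) (almost-all us)

          upward : ∀ {us v} y → All (Upward y) us → ¬ Q (λ x → P (x , v)) → v ∈ us → ¬ P (y , v)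
          upward y all c v∈ pyv with All.lookupAny all v∈
          ... | up , v≈ = up (c ∘ def-resp (Qᵈ p) (sym v≈)) (def-resp (fix₁ p y) v≈ pyv)

        -- Almost all `x` lie below almost all `y`, so some related pair avoids the parameters `a`.
        -- Transposing it would reverse the order.
        <-not-pure : ¬ DefinableRel (pureSet setoid) _<_
        <-not-pure (m , φ , a , h) =
          let x , gx , x∉a = Q-∃ (Q-× P-large (Q-∉ (tabulate a)))
              y , x<y , y∉a = Q-∃ (Q-× (<-large gx) (Q-∉ (tabulate a)))
              x≉y = λ e → irrefl e x<y
              y<x = from (h (y ◂ x ◂ λ ()))
                (PureSet.definable-swap setoid x≉y φ a x∉a y∉a (to (h (x ◂ y ◂ λ ())) x<y))
          in irrefl refl (<-trans x<y y<x)
          where open IsStrictPartialOrder <-isStrictPartialOrder using (irrefl) renaming (trans to <-trans)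

        contradiction : ∅
        contradiction = unordered (_<_ , <-isStrictPartialOrder , def⇒definableRel <-def , <-not-pure)

      -- By the ultrafilter property, a failure of commutation is exactly the situation of
      -- `Asymmetric`. Only here does the hypothesis `unordered` enter.
      Q-comm : ∀ {P : Pred (Carrier × Carrier) ℓ} → Def (pt ⊗ pt) P →
               Q (λ x → Q (λ y → P (x , y))) → Q (λ y → Q (λ x → P (x , y)))
      Q-comm p q = dne λ ¬q → Asymmetric.contradiction p q (¬Q⇒Q¬ (Qᵈ p) ¬q)

    -- Almost all tuples.

    Qs : ∀ n → Pred (Tuple Carrier n) ℓ → Set ℓ
    Qs zero    D = D tt
    Qs (suc n) D = Q (λ x → Qs n (λ t → D (x , t)))

    Qs-all : ∀ n {D : Pred (Tuple Carrier n) ℓ} → (∀ t → D t) → Qs n D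
    Qs-all zero    h = h tt
    Qs-all (suc n) h = Q-all λ x → Qs-all n λ t → h (x , t)

    Qs-∃ : ∀ n {D : Pred (Tuple Carrier n) ℓ} → Qs n D → ∃ D
    Qs-∃ zero    d = tt , d
    Qs-∃ (suc n) q = let x , q′ = Q-∃ q ; t , d = Qs-∃ n q′ in (x , t) , d

    Qs-mono : ∀ n {D E : Pred (Tuple Carrier n) ℓ} → (∀ t → D t → E t) → Qs n D → Qs n E
    Qs-mono zero    sub = sub tt
    Qs-mono (suc n) sub = Q-mono λ x → Qs-mono n λ t → sub (x , t)

    Qs-× : ∀ n {D E : Pred (Tuple Carrier n) ℓ} → Qs n D → Qs n E → Qs n (λ t → D t × E t)
    Qs-× zero    d e = d , e
    Qs-× (suc n) d e = Q-mono (λ x (p , q) → Qs-× n p q) (Q-× d e)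

    Qsᵈ : ∀ n {c} {P : Pred ⟦ tup n ⊗ c ⟧ ℓ} → Def (tup n ⊗ c) P → Def c (λ y → Qs n (λ t → P (t , y)))
    Qsᵈ zero    p = p [ fixᶠ tt ,ᶠ idᶠ ]
    Qsᵈ (suc n) p = Qᵈ (Qsᵈ n (p [ (π₁ ∘ᶠ π₂ ∷ᶠ π₁) ,ᶠ π₂ ∘ᶠ π₂ ]))

    ¬Qs⇒Qs¬ : ∀ n {D} → Def (tup n) D → ¬ Qs n D → Qs n (λ t → ¬ D t)
    ¬Qs⇒Qs¬ zero    D-def ¬d = ¬d
    ¬Qs⇒Qs¬ (suc n) D-def ¬q =
      Q-mono (λ x → ¬Qs⇒Qs¬ n (D-def [ fixᶠ x ∷ᶠ idᶠ ])) (¬Q⇒Q¬ (Qsᵈ n (D-def [ π₂ ∷ᶠ π₁ ])) ¬q)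

    -- Finite-to-one correspondences and dimension.

    Boxed : ∀ {n} → Pred (Tuple Carrier n) ℓ → Set ℓ
    Boxed D = ∃[ xs ] ∀ t → D t → t ∈* xs

    Boxed-Any : ∀ {n} {Z : Set ℓ} {R : Tuple Carrier n → Z → Set ℓ} → (∀ z → Boxed (λ t → R t z)) →
                ∀ zs → Boxed (λ t → Any (R t) zs)
    Boxed-Any box []       = [] , λ t ()
    Boxed-Any box (z ∷ zs) =
      let xs , h = box z
          ys , g = Boxed-Any box zs
      in xs ⧺ ys , λ { t (here p)  → ∈*-mono Any.++⁺ˡ (h t p)
                     ; t (there p) → ∈*-mono (Any.++⁺ʳ xs) (g t p) }

    -- Dropping one coordinate of z, at the price of finitely many choices when going back.
    record Shortening m {c p} (R : Pred ⟦ c ⊗ p ⊗ tup (suc m) ⟧ ℓ) : Set (lsuc ℓ ⊔ f ⊔ r) where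
      field
        R′     : Pred ⟦ c ⊗ p ⊗ tup m ⟧ ℓ
        R′-def : Def (c ⊗ p ⊗ tup m) R′
        drop   : ∀ a y z → R (a , y , z) → ∃[ z′ ] R′ (a , y , z′)
        -- The list is independent of `a`, so a correspondence with finite fibres over z keeps
        -- finite fibres over z′.
        lift   : ∀ y z′ → ∃[ zs ] ∀ a → R′ (a , y , z′) → Any (λ z → R (a , y , z)) zs
    open Shortening

    -- Case distinction on the first coordinate `x` of z. If the fibre of W over `x` is small, `x`
    -- becomes a parameter and the remaining coordinates are shortened by `IH`; otherwise `x` is one
    -- of finitely many exceptions and is dropped itself.
    module ShortenStep m c p (R : Pred ⟦ c ⊗ p ⊗ tup (suc (suc m)) ⟧ ℓ) (W : Pred ⟦ p ⊗ tup (suc (suc m)) ⟧ ℓ)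
      (R-def : Def (c ⊗ p ⊗ tup (suc (suc m))) R) (W-def : Def (p ⊗ tup (suc (suc m))) W)
      (small : ∀ y → Qs (suc (suc m)) (λ z → ¬ W (y , z))) where

      B : Pred ⟦ p ⊗ pt ⟧ ℓ
      B (y , x) = Qs (suc m) (λ z → ¬ W (y , x , z))

      B-def : Def (p ⊗ pt) B
      B-def = Qsᵈ (suc m) (¬ᵈ (W-def [ π₁ ∘ᶠ π₂ ,ᶠ (π₂ ∘ᶠ π₂ ∷ᶠ π₁) ]))

      S : Pred ⟦ c ⊗ (p ⊗ pt) ⊗ tup (suc m) ⟧ ℓ
      S (a , (y , x) , z) = R (a , y , x , z) × B (y , x)

      -- Conjoining B makes the smallness hypothesis true for all parameters, as the recursive call
      -- requires.
      V : Pred ⟦ (p ⊗ pt) ⊗ tup (suc m) ⟧ ℓ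
      V ((y , x) , z) = W (y , x , z) × B (y , x)

      V-small : ∀ y x → Qs (suc m) (λ z → ¬ V ((y , x) , z))
      V-small y x with em {P = B (y , x)}
      ... | yes b = Qs-mono (suc m) (λ z ¬w (w , _) → ¬w w) b
      ... | no ¬b = Qs-all (suc m) λ z (_ , b) → ¬b b

      S-def : Def (c ⊗ (p ⊗ pt) ⊗ tup (suc m)) S
      S-def = R-def [ π₁ ,ᶠ π₁ ∘ᶠ π₁ ∘ᶠ π₂ ,ᶠ (π₂ ∘ᶠ π₁ ∘ᶠ π₂ ∷ᶠ π₂ ∘ᶠ π₂) ] ×ᵈ B-def [ π₁ ∘ᶠ π₂ ]

      V-def : Def ((p ⊗ pt) ⊗ tup (suc m)) V
      V-def = W-def [ π₁ ∘ᶠ π₁ ,ᶠ (π₂ ∘ᶠ π₁ ∷ᶠ π₂) ] ×ᵈ B-def [ π₁ ]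

      module _ (IH : Shortening m {c} {p ⊗ pt} S) where
        R″ : Pred ⟦ c ⊗ p ⊗ tup (suc m) ⟧ ℓ
        R″ (a , y , z) = (∃[ x ] ¬ B (y , x) × R (a , y , x , z)) ⊎ R′ IH (a , (y , proj₁ z) , proj₂ z)

        drop″ : ∀ a y z → R (a , y , z) → ∃[ z′ ] R″ (a , y , z′)
        drop″ a y (x , z) r with em {P = B (y , x)}
        ... | yes b = let z′ , s = drop IH a (y , x) z (r , b) in (x , z′) , inj₂ s
        ... | no ¬b = z , inj₁ (x , ¬b , r)

        lift″ : ∀ y z′ → ∃[ zs ] ∀ a → R″ (a , y , z′) → Any (λ z → R (a , y , z)) zs
        lift″ y (x , z) =
          -- `small y` unfolds to cofiniteness of B (y , _), so `ws` lists all exceptional first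
          -- coordinates.
          let ws , g = small y
              zs , h = lift IH (y , x) z
          in map (_, x , z) ws ⧺ map (x ,_) zs , λ where
               a (inj₁ (w , ¬b , r)) → Any.++⁺ˡ (Any.map⁺ (Any.map
                 (λ e → def-resp (R-def [ fixᶠ a ,ᶠ fixᶠ y ,ᶠ (idᶠ ∷ᶠ fixᶠ (x , z)) ]) e r)
                 (g w ¬b)))
               a (inj₂ s) → Any.++⁺ʳ _ (Any.map⁺ (Any.map proj₁ (h a s)))

        step : Shortening (suc m) {c} {p} R
        step = record
          { R′     = R″
          ; R′-def = ∃ᵈ pt (¬ᵈ (B-def [ π₁ ∘ᶠ π₂ ∘ᶠ π₂ ,ᶠ π₁ ]) ×ᵈ
                            R-def [ π₁ ∘ᶠ π₂ ,ᶠ π₁ ∘ᶠ π₂ ∘ᶠ π₂ ,ᶠ (π₁ ∷ᶠ π₂ ∘ᶠ π₂ ∘ᶠ π₂) ])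
                     ⊎ᵈ R′-def IH [ π₁ ,ᶠ (π₁ ∘ᶠ π₂ ,ᶠ headᶠ ∘ᶠ π₂ ∘ᶠ π₂) ,ᶠ tailᶠ ∘ᶠ π₂ ∘ᶠ π₂ ]
          ; drop   = drop″
          ; lift   = lift″
          }

    -- If W is not large, then some coordinate of z ∈ W is algebraic over the preceding ones.
    shorten : ∀ m {c p} (R : Pred ⟦ c ⊗ p ⊗ tup (suc m) ⟧ ℓ) (W : Pred ⟦ p ⊗ tup (suc m) ⟧ ℓ) →
      Def (c ⊗ p ⊗ tup (suc m)) R → Def (p ⊗ tup (suc m)) W →
      (∀ y → Qs (suc m) (λ z → ¬ W (y , z))) → (∀ a y z → R (a , y , z) → W (y , z)) →
      Shortening m {c} {p} R
    shorten zero {c} {p} R W R-def W-def small R⊆W = record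
      { R′     = λ (a , y , _) → ∃[ x ] R (a , y , x , tt)
      ; R′-def = ∃ᵈ pt (R-def [ π₁ ∘ᶠ π₂ ,ᶠ π₁ ∘ᶠ π₂ ∘ᶠ π₂ ,ᶠ (π₁ ∷ᶠ fixᶠ tt) ])
      ; drop   = λ a y z r → tt , proj₁ z , r
      ; lift   = λ y _ → map (_, tt) (proj₁ (small y)) , λ a (x , r) →
          Any.map⁺ (Any.map (λ e → def-resp (R-def [ fixᶠ a ,ᶠ fixᶠ y ,ᶠ (idᶠ ∷ᶠ fixᶠ tt) ]) e r)
                            (proj₂ (small y) x (λ ¬w → ¬w (R⊆W a y (x , tt) r))))
      }
    shorten (suc m) {c} {p} R W R-def W-def small R⊆W =
      step (shorten m {c} {p ⊗ pt} S V S-def V-def (λ (y , x) → V-small y x)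
                    (λ a (y , x) z (r , b) → R⊆W a y (x , z) r , b))
      where open ShortenStep m c p R W R-def W-def small

    module _ (Q-comm : ∀ {P : Pred (Carrier × Carrier) ℓ} → Def (pt ⊗ pt) P →
                       Q (λ x → Q (λ y → P (x , y))) → Q (λ y → Q (λ x → P (x , y)))) where

      Qs-comm : ∀ n {P} → Def (pt ⊗ tup n) P →
                Qs n (λ z → Q (λ x → P (x , z))) → Q (λ x → Qs n (λ z → P (x , z)))
      Qs-comm zero    p q = q
      Qs-comm (suc n) p q =
        Q-comm (Qsᵈ n (p [ π₂ ∘ᶠ π₂ ,ᶠ (π₁ ∘ᶠ π₂ ∷ᶠ π₁) ]))
               (Q-mono (λ z → Qs-comm n (p [ π₁ ,ᶠ (fixᶠ z ∷ᶠ π₂) ])) q)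

      -- Induction on `n`. Each z is related to finitely many first coordinates x, so by commutation
      -- a generic x is related to few z. Fixing such an x removes one coordinate on the left, and
      -- `shorten` removes one on the right.
      not-coverable : ∀ n {R} → Def (tup (suc n) ⊗ tup n) R → (∀ z → Boxed (λ x → R (x , z))) →
                      ¬ Qs (suc n) (λ x → ∃[ z ] R (x , z))
      not-coverable zero R-def box q =
        Q⇒¬Q¬ q (finite⇒Q¬ (proj₁ (box tt) , λ x (_ , r) → proj₁ (proj₂ (box tt) _ r)))
      not-coverable (suc n) {R} R-def box q =
        let x , q′ , small = Q-∃ (Q-× q (Qs-comm (suc n) (¬ᵈ T-def) (Qs-all (suc n) T-finite)))
            short = shorten n {tup (suc n)} {tup 0}
              (λ (t , _ , z) → R ((x , t) , z)) (λ (_ , z) → T (x , z))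
              (R-def [ (fixᶠ x ∷ᶠ π₁) ,ᶠ π₂ ∘ᶠ π₂ ]) (T-def [ fixᶠ x ,ᶠ π₂ ])
              (λ _ → small) (λ t _ _ r → t , r)
        in not-coverable n (R′-def short [ π₁ ,ᶠ fixᶠ tt ,ᶠ π₂ ])
             (λ z → let zs , h = lift short tt z
                        xs , g = Boxed-Any (λ z → proj₁ (box z) , λ t r → proj₂ (proj₂ (box z) (x , t) r)) zs
                    in xs , λ t → g t ∘ h t)
             (Qs-mono (suc n) (λ t (z , r) → drop short t tt z r) q′)
        where
        T : Pred ⟦ pt ⊗ tup (suc n) ⟧ ℓ
        T (x , z) = ∃[ t ] R ((x , t) , z)

        T-def : Def (pt ⊗ tup (suc n)) T
        T-def = ∃ᵈ (tup (suc n)) (R-def [ (π₁ ∘ᶠ π₂ ∷ᶠ π₁) ,ᶠ π₂ ∘ᶠ π₂ ])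

        T-finite : ∀ z → Q (λ x → ¬ T (x , z))
        T-finite z = finite⇒Q¬ (proj₁ (box z) , λ x (t , r) → proj₁ (proj₂ (box z) (x , t) r))

      -- If the image were not large, `shorten` would remove one of its coordinates, against
      -- `not-coverable`.
      finite-to-one-large : ∀ n {R} → Def (tup n ⊗ tup n) R → (∀ z → Boxed (λ x → R (x , z))) →
                            Qs n (λ x → ∃[ z ] R (x , z)) → Qs n (λ z → ∃[ x ] R (x , z))
      finite-to-one-large zero    R-def box q = q
      finite-to-one-large (suc n) {R} R-def box q = dne λ ¬q →
        let short = shorten n {tup (suc n)} {tup 0}
              (λ (x , _ , z) → R (x , z)) (λ (_ , z) → ∃[ x ] R (x , z))
              (R-def [ π₁ ,ᶠ π₂ ∘ᶠ π₂ ]) (∃ᵈ (tup (suc n)) R-def [ π₂ ])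
              (λ _ → ¬Qs⇒Qs¬ (suc n) (∃ᵈ (tup (suc n)) R-def) ¬q) (λ x _ _ r → x , r)
        in not-coverable n (R′-def short [ π₁ ,ᶠ fixᶠ tt ,ᶠ π₂ ])
             (λ z → let zs , h = lift short tt z
                        xs , g = Boxed-Any box zs
                    in xs , λ t → g t ∘ h t)
             (Qs-mono (suc n) (λ t (z , r) → drop short t tt z r) q)

      -- Contradiction from a polynomial without a root.

      module NoRoot d (f : Tuple Carrier (suc d)) (φ≉0 : ¬ top d f ≈ 0#)
                    (no-root : ∀ x → ¬ eval (suc d) f x ≈ 0#)
                    (solvable : ∀ k → k ≤ d → RootOrConstant k) (1≤d : 1 ≤ d)
                    (nonconstant-large : Qs d (λ a → ¬ (∃[ c ] ∀ x → eval d a x ≈ c))) where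
        open Extension d f φ≉0 no-root solvable

        -- A length sufficient for e(a(X)), and by `divide` also for its quotient by f. It makes
        -- divisibility of e(a(X)) by f first-order.
        N = compose-length (suc d) d

        Nonzero : Pred ⟦ tup (suc d) ⟧ ℓ
        Nonzero e = ∃[ y ] ¬ eval (suc d) e y ≈ 0#

        nonzeroᵈ : Def (tup (suc d)) Nonzero
        nonzeroᵈ = ∃ᵈ pt (¬ᵈ (≈ᵈ (evalᶠ (suc d) π₂ π₁) (fixᶠ 0#)))

        Multiple : Pred ⟦ tup d ⊗ tup (suc d) ⟧ ℓ
        Multiple (a , e) = ∃[ h ] ∀ x → eval (suc d) e (eval d a x) ≈ f̂ x * eval N h x

        multipleᵈ : Def (tup d ⊗ tup (suc d)) Multiple
        multipleᵈ = ∃ᵈ (tup N) (∀ᵈ (≈ᵈ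
          (evalᶠ (suc d) (π₂ ∘ᶠ π₂ ∘ᶠ π₂) (evalᶠ d (π₁ ∘ᶠ π₂ ∘ᶠ π₂) π₁))
          (evalᶠ (suc d) (fixᶠ f) π₁ *ᶠ evalᶠ N (π₁ ∘ᶠ π₂) π₁)))

        multiple⇒div : ∀ a e → Multiple (a , e) → Div (λ x → eval (suc d) e (eval d a x))
        multiple⇒div a e (h , eq) = eval N h , (N , pf-eval N h) , eq

        -- A cofactor of unspecified length is replaced by the quotient from `divide`; the remainder
        -- is divisible by f and of degree below `d`, hence zero.
        div⇒multiple : ∀ a e → Div (λ x → eval (suc d) e (eval d a x)) → Multiple (a , e)
        div⇒multiple a e div =
          let Z , H , Z-pf , (h , H≈h) , eq = divide d f φ≉0 N (pf-∘ (suc d) e (pf-eval d a))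
              Z-div = div-cancel (div-resp (λ x → sym (eq x)) div)
                        (H , (N , h , H≈h) , λ x → refl)
          in h , λ x → trans (eq x) (trans (+-congʳ (div-low-degree Z-pf Z-div x))
                         (trans (+-identityˡ _) (*-congˡ (H≈h x))))

        -- 1, a, …, a^d are linearly dependent modulo f, since otherwise e ↦ e(a) mod f would embed
        -- K^(d+1) into K^d.
        annihilator : ∀ a → ∃[ e ] Nonzero e × Div (λ x → eval (suc d) e (eval d a x))
        annihilator a = dne λ none →
          not-coverable d R-def (box none) (Qs-all (suc d) total)
          where
          R : Pred ⟦ tup (suc d) ⊗ tup d ⟧ ℓ
          R (e , z) = ∃[ h ] ∀ x → eval (suc d) e (eval d a x) ≈ eval d z x + f̂ x * eval N h x

          R-def : Def (tup (suc d) ⊗ tup d) R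
          R-def = ∃ᵈ (tup N) (∀ᵈ (≈ᵈ
            (evalᶠ (suc d) (π₁ ∘ᶠ π₂ ∘ᶠ π₂) (evalᶠ d (fixᶠ a) π₁))
            (evalᶠ d (π₂ ∘ᶠ π₂ ∘ᶠ π₂) π₁ +ᶠ evalᶠ (suc d) (fixᶠ f) π₁ *ᶠ evalᶠ N (π₁ ∘ᶠ π₂) π₁)))

          total : ∀ e → ∃[ z ] R (e , z)
          total e =
            let Z , H , (z , Z≈z) , (h , H≈h) , eq = divide d f φ≉0 N (pf-∘ (suc d) e (pf-eval d a))
            in z , h , λ x → trans (eq x) (+-cong (Z≈z x) (*-congˡ (H≈h x)))

          difference-div : ∀ e e′ z → R (e , z) → R (e′ , z) →
            Div (λ x → eval (suc d) e (eval d a x) + - eval (suc d) e′ (eval d a x))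
          difference-div e e′ z (h , eq) (h′ , eq′) = div-cancel
            {λ x → eval (suc d) e (eval d a x) + - eval (suc d) e′ (eval d a x)} {λ x → f̂ x * eval N h′ x}
            (div-resp (λ x → trans (+-cong (+-cong (eq x) (-‿cong (eq′ x))) refl)
                (difference-cancel (eval d z x) (f̂ x * eval N h x) (f̂ x * eval N h′ x)))
              (eval N h , (N , pf-eval N h) , λ x → refl))
            (eval N h′ , (N , pf-eval N h′) , λ x → refl)

          box : ¬ (∃[ e ] Nonzero e × Div (λ x → eval (suc d) e (eval d a x))) →
                ∀ z → Boxed (λ e → R (e , z))
          box none z with em {P = ∃[ e ] R (e , z)}
          ... | no ¬r        = [] , λ e r → ⊥-elim (¬r (e , r))
          -- Two polynomials with the same remainder differ by one that annihilates `a`, so by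
          -- `none` they coincide.
          ... | yes (e′ , r′) = entries e′ , λ e r → eval-injective (suc d) e e′ λ y → x-y≈0⇒x≈y (dne λ y≉0 →
            let t , t≈ = pf-+ (suc d) (pf-eval (suc d) e) (pf-neg (suc d) (pf-eval (suc d) e′))
            in none (t , (y , y≉0 ∘ trans (t≈ y)) ,
                     div-resp (λ x → sym (t≈ (eval d a x))) (difference-div e e′ z r r′)))

        -- The extra coordinate c, an entry of e, accounts for e being determined up to a scalar.
        S : Pred ⟦ tup (suc d) ⊗ tup (suc d) ⟧ ℓ
        S ((c , a) , e) = Nonzero e × c ∈ entries e × Multiple (a , e) × ¬ (∃[ c ] ∀ x → eval d a x ≈ c)

        S-def : Def (tup (suc d) ⊗ tup (suc d)) S
        S-def = nonzeroᵈ [ π₂ ] ×ᵈ ∈-entriesᵈ (suc d) (headᶠ ∘ᶠ π₁) π₂ ×ᵈ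
                multipleᵈ [ tailᶠ ∘ᶠ π₁ ,ᶠ π₂ ] ×ᵈ
                ¬ᵈ (∃ᵈ pt (∀ᵈ (≈ᵈ (evalᶠ d (tailᶠ ∘ᶠ π₁ ∘ᶠ π₂ ∘ᶠ π₂) π₁) (π₁ ∘ᶠ π₂))))

        -- Given `e`, the element c is one of its coefficients and a one of its finitely many roots
        -- in K[X]/(f).
        S-box : ∀ e → Boxed (λ t → S (t , e))
        S-box e with em {P = Nonzero e}
        ... | no ¬nz = [] , λ t (nz , _) → ⊥-elim (¬nz nz)
        ... | yes nz =
          let xs , h = composition-roots-finite e 1≤d nz
          in entries e ⧺ xs , λ (c , a) (_ , c∈ , mult , _) →
               Any.++⁺ˡ c∈ , ∈*-mono (Any.++⁺ʳ (entries e)) (h a (multiple⇒div a e mult))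

        S-total : ∀ c → ¬ c ≈ 0# → ∀ a → ¬ (∃[ c ] ∀ x → eval d a x ≈ c) → ∃[ e ] S ((c , a) , e)
        S-total c c≉0 a nonconstant =
          let e , (y , y≉0) , div = annihilator a
              μ , μ≉0 , s , c∈ , s≈ = rescale (suc d) e (y , y≉0) c≉0
          in s , (y , λ sy≈0 → y≉0 (x*y≈0⇒y≈0 μ≉0 (trans (sym (s≈ y)) sy≈0))) , c∈
           , div⇒multiple a s (div-resp (λ x → s≈ (eval d a x)) (div-*ˡ (poly-const μ) div))
           , nonconstant

        S-large : Qs (suc d) (λ e → ∃[ t ] S (t , e))
        S-large = finite-to-one-large (suc d) S-def S-box
          (Q-mono (λ c c≉0 → Qs-mono d (λ a → S-total c c≉0 a) nonconstant-large) (Q-≉ 0#))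

        -- Polynomials that split over K, with the tuple r of their roots. As in `S`, the coordinate
        -- c is a coefficient of e, not necessarily the leading one.
        T : Pred ⟦ tup (suc d) ⊗ tup (suc d) ⟧ ℓ
        T ((c , r) , e) = Nonzero e × c ∈ entries e × (∃[ μ ] ∀ x → eval (suc d) e x ≈ μ * product d r x)

        T-def : Def (tup (suc d) ⊗ tup (suc d)) T
        T-def = nonzeroᵈ [ π₂ ] ×ᵈ ∈-entriesᵈ (suc d) (headᶠ ∘ᶠ π₁) π₂ ×ᵈ
                ∃ᵈ pt (∀ᵈ (≈ᵈ (evalᶠ (suc d) (π₂ ∘ᶠ π₂ ∘ᶠ π₂) π₁)
                              (π₁ ∘ᶠ π₂ *ᶠ productᶠ d (tailᶠ ∘ᶠ π₁ ∘ᶠ π₂ ∘ᶠ π₂) π₁)))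

        T-box : ∀ e → Boxed (λ t → T (t , e))
        T-box e with em {P = Nonzero e}
        ... | no ¬nz = [] , λ t (nz , _) → ⊥-elim (¬nz nz)
        ... | yes nz =
          let xs , h = roots-finite (suc d) e nz
          in entries e ⧺ xs , λ (c , r) (_ , c∈ , μ , e≈) →
               Any.++⁺ˡ c∈ , ∈*-mono (Any.++⁺ʳ (entries e)) (product-roots d r xs λ x p≈0 →
                 h x (trans (e≈ x) (trans (*-congˡ p≈0) (zeroʳ μ))))

        T-total : ∀ c → ¬ c ≈ 0# → ∀ r → ∃[ e ] T ((c , r) , e)
        T-total c c≉0 r =
          let t , t≈ = pf-product d r
              y , y∉ = fresh (entries r)
              ty≉0 = product≉0 d r y∉ ∘ trans (t≈ y)
              μ , μ≉0 , s , c∈ , s≈ = rescale (suc d) t (y , ty≉0) c≉0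
          in s , (y , λ sy≈0 → ty≉0 (x*y≈0⇒y≈0 μ≉0 (trans (sym (s≈ y)) sy≈0))) , c∈
           , μ , λ x → trans (s≈ x) (*-congˡ (sym (t≈ x)))

        T-large : Qs (suc d) (λ e → ∃[ t ] T (t , e))
        T-large = finite-to-one-large (suc d) T-def T-box
          (Q-mono (λ c c≉0 → Qs-all d (T-total c c≉0)) (Q-≉ 0#))

        -- Each factor a(X) - r is nonzero of degree below `d`, so `prime` cancels it; in the end f
        -- would divide 1.
        product-indivisible : ∀ a → ¬ (∃[ c ] ∀ x → eval d a x ≈ c) →
                              ∀ n r → ¬ Div (λ x → product n r (eval d a x))
        product-indivisible a nonconstant zero    r       div = 0≉1 (sym (div-low-degree (pf-1 1≤d) div 0#))
          where
          pf-1 : ∀ {d} → 1 ≤ d → PF d (λ _ → 1#)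
          pf-1 (s≤s _) = pf-const _ 1#
        product-indivisible a nonconstant (suc n) (r , t) div =
          let s , s≈ = pf-+ d (pf-eval d a) (pf-neg d (pf-r 1≤d))
              p , p≈ = pf-product n t
          in nonconstant (r , λ x → x-y≈0⇒x≈y (dne λ x≉0 →
               product-indivisible a nonconstant n t
                 (prime d ℕ.≤-refl s (x , x≉0 ∘ trans (s≈ x))
                   (_ , pf-resp (λ x → p≈ (eval d a x)) (pf-∘ (suc n) p (pf-eval d a)))
                   (div-resp (λ x → *-congʳ (sym (s≈ x))) div))))
          where
          pf-r : ∀ {d} → 1 ≤ d → PF d (λ _ → r)
          pf-r (s≤s _) = pf-const _ r

        -- A polynomial that splits over K has no root in K[X]/(f) outside K.
        absurd : ∅
        absurd =
          let e , ((_ , a) , (y , y≉0) , _ , mult , nonconstant) , ((_ , r) , _ , _ , μ , e≈) =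
                Qs-∃ (suc d) (Qs-× (suc d) S-large T-large)
              μ≉0 = λ μ≈0 → y≉0 (trans (e≈ y) (trans (*-congʳ μ≈0) (zeroˡ _)))
              i , μi≈1 = inverse μ μ≉0
          in product-indivisible a nonconstant d r
               (div-resp (λ x → trans (sym (*-identityˡ _))
                   (trans (*-congʳ (trans (sym μi≈1) (*-comm μ i)))
                     (trans (*-assoc i μ _) (*-congˡ (sym (e≈ (eval d a x)))))))
                 (div-*ˡ (poly-const i) (multiple⇒div a e mult)))

      -- Induction on the number of coefficients.

      nonconstant-large : ∀ m → Qs (suc (suc m)) (λ a → ¬ (∃[ c ] ∀ x → eval (suc (suc m)) a x ≈ c))
      nonconstant-large m = Q-all λ a → Q-mono
        (λ b b≉0 → Qs-all m λ t (c , e) → b≉0 (trans (sym (eval-0 m b t))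
          (eval-≈⇒tail-≈ (suc m) 0 a c (b , t) tt (λ x →
            trans (e x) (sym (trans (+-congˡ (zeroʳ x)) (+-identityʳ c)))) 0#)))
        (Q-≉ 0#)

      -- Leading coefficients may vanish, so the induction runs over numbers of coefficients and
      -- admits constants. From three coefficients on, either the top one is zero and can be
      -- removed, or the absence of a root is refuted by `NoRoot`.
      root-or-constant-suc : ∀ n → (∀ k → k ≤ n → RootOrConstant k) → RootOrConstant (suc n)
      root-or-constant-suc zero          solvable (a , _) =
        inj₂ (a , λ x → trans (+-congˡ (zeroʳ x)) (+-identityʳ a))
      root-or-constant-suc (suc zero)    solvable f = root-or-constant-2 f
      root-or-constant-suc (suc (suc m)) solvable f = case em em
        where
        d = suc (suc m)

        case : Dec (∃[ x ] eval (suc d) f x ≈ 0#) → Dec (top d f ≈ 0#) →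
               (∃[ x ] eval (suc d) f x ≈ 0#) ⊎ (∃[ c ] ∀ x → eval (suc d) f x ≈ c)
        case (yes root)   _         = inj₁ root
        case (no no-root) (no φ≉0)  = ⊥-elim (NoRoot.absurd d f φ≉0 (λ x e → no-root (x , e))
          solvable (s≤s z≤n) (nonconstant-large m))
        case (no no-root) (yes φ≈0) = lower (solvable d ℕ.≤-refl (init d f))
          where
          f≈init : ∀ x → eval (suc d) f x ≈ eval d (init d f) x
          f≈init x = trans (eval-top d f x)
            (trans (+-congˡ (trans (*-congʳ φ≈0) (zeroˡ _))) (+-identityʳ _))

          lower : (∃[ x ] eval d (init d f) x ≈ 0#) ⊎ (∃[ c ] ∀ x → eval d (init d f) x ≈ c) →
                  (∃[ x ] eval (suc d) f x ≈ 0#) ⊎ (∃[ c ] ∀ x → eval (suc d) f x ≈ c)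
          lower (inj₁ (x , e)) = inj₁ (x , trans (f≈init x) e)
          lower (inj₂ (c , e)) = inj₂ (c , λ x → trans (f≈init x) (e x))

      root-or-constant : ∀ n k → k ≤ n → RootOrConstant k
      root-or-constant n       zero    _         t = inj₁ (0# , refl)
      root-or-constant (suc n) (suc k) (s≤s k≤n) with ℕ.m≤n⇒m<n∨m≡n k≤n
      ... | inj₁ k<n    = root-or-constant n (suc k) k<n
      ... | inj₂ ≡.refl = root-or-constant-suc n (root-or-constant n)

      algebraicallyClosed : AlgebraicallyClosed K
      algebraicallyClosed p nonconstant = root-or-constant⇒root p nonconstant
        (root-or-constant (length p) (length p) ℕ.≤-refl (toTuple p))

theorem1 : (∀ {a} → ExcludedMiddle a) →
    ∀ {ℓ f r} (K : Field ℓ) (L : Signature f r) (A : Structure L (Field.setoid K)) →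
    Minimal (expansion K A) → Unordered (expansion K A) → AlgebraicallyClosed K
theorem1 em K L A minimal unordered = algebraicallyClosed (Q-comm unordered)
  where open MinimalField em K L A minimal
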